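{- Let $n\ge 1$ and let $w\in S_n$. Then $x^{\delta_n}\mathfrak{S}_w(x^{ -1}) = x_1^{n-1}x_2^{n-2}\cdots x_{n-1}^{1}\,\mathfrak{S}_w(x_1^{ -1},\ldots,x_n^{ -1})$ is a Schubert polynomial if and only if $w$ avoids the patterns $132$ and $312$.
   Context: $S_n$ is the symmetric group of permutations $w=w_1w_2\cdots w_n$ of $[n]=\{1,\ldots,n\}$, and $s_i$ is the adjacent transposition of $i$ and $i+1$; $ws_i$ is obtained from $w$ by swapping $w_i$ and $w_{i+1}$. For a polynomial $f$, the divided difference is $\partial_i f=(f-s_if)/(x_i-x_{i+1})$, where $s_if$ swaps $x_i$ and $x_{i+1}$. Schubert polynomials: for $w_0=n\cdots 21$, $\mathfrak{S}_{w_0}(x)=x_1^{n-1}x_2^{n-2}\cdots x_{n-1}$, and for $w\ne w_0$ choose $i$ with $w_i<w_{i+1}$ and set $\mathfrak{S}_w(x)=\partial_i\mathfrak{S}_{ws_i}(x)$ (well defined). Appending fixed points $n+1,\ldots,m$ to $w$ does not change $\mathfrak{S}_w$; "a Schubert polynomial" means $\mathfrak{S}_{u}(x)$ for some permutation $u$ (of some $[m]$). $\delta_n=(n-1,n-2,\ldots,1,0)$ and $x^\mu=x_1^{\mu_1}\cdots x_n^{\mu_n}$. A permutation $w$ avoids $132$ if there are no $i<j<k$ with $w_i<w_k<w_j$, and avoids $312$ if there are no $i<j<k$ with $w_j<w_k<w_i$. -}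

module Defs where

open import Data.Nat as ℕ using (ℕ; zero; suc; _∸_; _⊔_)
open import Data.Integer as ℤ using (ℤ; +_; -_)
open import Data.Bool using (Bool; true; false; if_then_else_; _∧_)
open import Data.List using (List; []; _∷_; _++_; map; concatMap; upTo; length; reverse; replicate)
open import Data.Product using (_×_; _,_; Σ; Σ-syntax)
open import Relation.Nullary using (¬_)
open import Relation.Nullary.Decidable using (⌊_⌋)
open import Relation.Binary.PropositionalEquality using (_≡_)
open import Data.List.Relation.Binary.Permutation.Propositional using (_↭_)

-- Laurent polynomials in x₁, x₂, … with integer coefficients.
-- An exponent vector is a list of integers (position j ↦ exponent of
-- x_{j+1}); missing trailing entries mean exponent 0.  A polynomial is a
-- finite formal sum of terms (coefficient , exponent vector); two
-- polynomials are equal (≈) iff all their coefficients agree.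

Exp : Set
Exp = List ℤ

Term : Set
Term = ℤ × Exp

Poly : Set
Poly = List Term

expAt : Exp → ℕ → ℤ
expAt []      _       = + 0
expAt (a ∷ e) zero    = a
expAt (a ∷ e) (suc j) = expAt e j

isZero : ℤ → Bool
isZero a = ⌊ a ℤ.≟ + 0 ⌋

sameExp : Exp → Exp → Bool
sameExp []      []      = true
sameExp []      (b ∷ f) = isZero b ∧ sameExp [] f
sameExp (a ∷ e) []      = isZero a ∧ sameExp e []
sameExp (a ∷ e) (b ∷ f) = ⌊ a ℤ.≟ b ⌋ ∧ sameExp e f

coeff : Poly → Exp → ℤ
coeff []             α = + 0
coeff ((c , e) ∷ p) α = (if sameExp e α then c else + 0) ℤ.+ coeff p α

infix 4 _≈_
_≈_ : Poly → Poly → Set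
p ≈ q = ∀ α → coeff p α ≡ coeff q α

infixl 6 _⊕_ _⊖_
infixl 7 _⊗_

_⊕_ : Poly → Poly → Poly
p ⊕ q = p ++ q

negP : Poly → Poly
negP = map (λ { (c , e) → (ℤ.- c , e) })

_⊖_ : Poly → Poly → Poly
p ⊖ q = p ++ negP q

addExp : Exp → Exp → Exp
addExp []      f       = f
addExp (a ∷ e) []      = a ∷ e
addExp (a ∷ e) (b ∷ f) = (a ℤ.+ b) ∷ addExp e f

_⊗_ : Poly → Poly → Poly
p ⊗ q = concatMap (λ { (c , e) → map (λ { (d , f) → (c ℤ.* d , addExp e f) }) q }) p

-- the variable x_{j+1} (0-indexed j)
var : ℕ → Poly
var j = (+ 1 , replicate j (+ 0) ++ (+ 1 ∷ [])) ∷ []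

-- s_{k+1} acting on polynomials: swap x_{k+1} and x_{k+2} (0-indexed k)
swapIdx : ℕ → ℕ → ℕ
swapIdx k j with j ℕ.≟ k | j ℕ.≟ suc k
... | Relation.Nullary.yes _ | _ = suc k
... | Relation.Nullary.no _  | Relation.Nullary.yes _ = k
... | Relation.Nullary.no _  | Relation.Nullary.no _  = j

swapExp : ℕ → Exp → Exp
swapExp k e = map (λ j → expAt e (swapIdx k j)) (upTo (length e ⊔ suc (suc k)))

sP : ℕ → Poly → Poly
sP k = map (λ { (c , e) → (c , swapExp k e) })

xδ : ℕ → Poly
xδ n = (+ 1 , map (λ j → + (n ∸ suc j)) (upTo n)) ∷ []

negFirst : ℕ → Exp → Exp
negFirst zero    e       = e
negFirst (suc n) []      = []
negFirst (suc n) (a ∷ e) = ℤ.- a ∷ negFirst n e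

invSub : ℕ → Poly → Poly
invSub n = map (λ { (c , e) → (c , negFirst n e) })

-- Permutations in one-line notation w = w₁ w₂ ⋯ w_n (a list of ℕ).

range : ℕ → List ℕ
range n = map suc (upTo n)

IsPerm : ℕ → List ℕ → Set
IsPerm n w = w ↭ range n

w₀ : ℕ → List ℕ
w₀ n = reverse (range n)

-- entry at 0-indexed position (default 0 outside)
at : List ℕ → ℕ → ℕ
at []      _       = 0
at (a ∷ w) zero    = a
at (a ∷ w) (suc k) = at w k

-- w s_{k+1}: swap the entries at 0-indexed positions k and k+1
swapAt : ℕ → List ℕ → List ℕ
swapAt zero    (a ∷ b ∷ w) = b ∷ a ∷ w
swapAt zero    w           = w
swapAt (suc k) []          = []
swapAt (suc k) (a ∷ w)     = a ∷ swapAt k w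

-- Schubert polynomials, following the definition literally:
-- 𝔖_{w₀} = x^{δ_n}, and 𝔖_w = ∂_i 𝔖_{w s_i} whenever w_i < w_{i+1},
-- where ∂_i f is the polynomial g with (x_i - x_{i+1}) g = f - s_i f.
-- (Here i = k+1 with k 0-indexed.)  Schubert n w P means P = 𝔖_w for w ∈ S_n.

data Schubert (n : ℕ) : List ℕ → Poly → Set where
  longest : ∀ {P} → P ≈ xδ n → Schubert n (w₀ n) P
  divided : ∀ {w P Q} (k : ℕ) → suc k ℕ.< n → at w k ℕ.< at w (suc k) →
            Schubert n (swapAt k w) Q →
            (var k ⊖ var (suc k)) ⊗ P ≈ Q ⊖ sP k Q →
            Schubert n w P

IsSchubertPoly : Poly → Set
IsSchubertPoly R = Σ[ m ∈ ℕ ] Σ[ u ∈ List ℕ ] Σ[ Q ∈ Poly ]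
  (IsPerm m u × Schubert m u Q × Q ≈ R)

Avoids132 : List ℕ → Set
Avoids132 w = ∀ i j k → i ℕ.< j → j ℕ.< k → k ℕ.< length w →
  ¬ (at w i ℕ.< at w k × at w k ℕ.< at w j)

Avoids312 : List ℕ → Set
Avoids312 w = ∀ i j k → i ℕ.< j → j ℕ.< k → k ℕ.< length w →
  ¬ (at w j ℕ.< at w k × at w k ℕ.< at w i)

{-# OPTIONS --safe #-}
module Submission where

-- Pipe dreams give a polynomial F w with nonnegative coefficients.  Exchanging two adjacent rows
-- changes it as a divided difference does, and x_i - x_{i+1} can be cancelled, so F w = 𝔖_w.
-- All exponents of F w lie, in dominance order, between the code of w and the conjugate Λ of the
-- list of numbers "larger entries to the left", and both ends occur.
--
-- If w avoids 132, only the code occurs; if w also avoids 312, the word u with u_i = n + 1 - w_i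
-- avoids 132 and has code δ_n - code w.
--
-- Conversely let F u = x^δ F w(x⁻¹).  Comparing extreme exponents, Λ w + code u = δ_n; second
-- differences show that the codes of w and u drop by at most 1, which is avoidance of 312, and
-- that w cannot have a descent at i when u_{i+1} is smaller than all earlier entries of u.  If w
-- has no descent at i, then F w is symmetric in x_i and x_{i+1}, so ∂_i F u = F u / x_i, and
-- comparing Λ for u and u s_i shows that u has a descent at i and that u_{i+1} is smaller than
-- all earlier entries.  By induction on i the same holds at every descent of w, which together
-- with avoidance of 312 gives avoidance of 132.

open import Defs
open import Data.Nat as ℕ hiding (_/_)
open import Data.List using (List)
open import Data.Product using (_×_)
open import Function.Bundles using (_⇔_)
open import Data.Nat.Properties
open import Data.Bool using (Bool; true; false; if_then_else_; _∧_)
open import Data.Bool.Properties using (T-≡)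
open import Data.Integer as ℤ using (ℤ; +_; -[1+_]; ∣_∣)
import Data.Integer.Properties as ℤₚ
open import Data.List using ([]; _∷_; _++_; map; concatMap; length; upTo; applyUpTo; applyDownFrom; replicate; reverse)
open import Data.List.Properties using (++-identityʳ; length-map; length-upTo; map-applyUpTo; reverse-applyUpTo)
open import Data.List.Membership.Propositional using (_∈_; find; lose)
open import Data.List.Membership.Propositional.Properties
  using (∈-map⁻; ∈-map⁺; ∈-++⁻; ∈-++⁺ˡ; ∈-++⁺ʳ; ∈-concatMap⁺; ∈-concatMap⁻)
open import Data.List.Relation.Unary.Any using (here; there)
open import Data.List.Relation.Unary.All as All using (All; []; _∷_)
import Data.List.Relation.Unary.All.Properties as Allₚ
open import Data.List.Relation.Unary.AllPairs as AllPairs using (AllPairs; []; _∷_)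
import Data.List.Relation.Unary.AllPairs.Properties as AllPairsₚ
open import Data.List.Relation.Unary.Unique.Propositional using (Unique)
open import Data.List.Relation.Binary.Permutation.Propositional
  using (_↭_; prep; ↭-refl; ↭-sym; ↭⇒↭ₛ)
  renaming (refl to ↭refl; swap to ↭swap; trans to ↭trans)
open import Data.List.Relation.Binary.Permutation.Propositional.Properties
  using (All-resp-↭; ∈-resp-↭; drop-∷; ↭-reverse; ↭-length; ↭-empty-inv)
  renaming (map⁺ to ↭-map⁺)
import Data.List.Relation.Binary.Permutation.Setoid.Properties as SetoidPerm
open import Data.Product using (_,_; proj₁; proj₂; ∃)
open import Data.Sum using (_⊎_; inj₁; inj₂)
open import Data.Empty using (⊥-elim)
open import Function using (_∘_; id; Equivalence)
open import Function.Bundles using (mk⇔)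
open import Relation.Nullary using (¬_; Dec; yes; no)
open import Relation.Nullary.Decidable using (⌊_⌋; map′; _×-dec_)
open import Relation.Binary using (tri<; tri≈; tri>)
open import Relation.Binary.PropositionalEquality
open import Data.Nat.Solver using (module +-*-Solver)
open +-*-Solver using (solve; _:+_; _:=_; con)
open import Data.Integer.Solver renaming (module +-*-Solver to ℤ-Solver)
open ℤ-Solver using ()
  renaming (solve to solveℤ; _:+_ to _⊞_; _:-_ to _⊟_; :-_ to ⊟_; _:=_ to _⊜_; con to conℤ)
open import Algebra.Properties.CommutativeSemigroup +-commutativeSemigroup using (interchange; x∙yz≈y∙xz)

-- Nothing ties the size of `u` to n, but `Dual` is symmetric in its two words; so every fact is
-- proved for an arbitrary dual pair and used with the words in either order. All coefficients of
-- `F` count pipe dreams, so nothing cancels and the support is exactly the set of paths; this lets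
-- extreme exponents be read through the complement. The lower extreme comes from inversions: each
-- crossing removes one, and the first i rows have to deal with those that start in the first i
-- positions. The upper extreme comes from the fact that one row crosses a given entry at most once,
-- so y adds at most min(i, `L w y`) to the first i rows. The second difference of min(i, l) in i is
-- -1 where the middle index is l and 0 elsewhere, and that of the prefix sums of δ_n is -1. Hence
-- from q to q + 1 < n the code of `u` drops by 1 minus the number of y with `L w y` = q + 1. A drop
-- of 2 is impossible, and an entry with that value of `L`, such as a left-to-right minimum of `w`
-- at q + 1, forbids any drop.

private variable
  A B : Set

-- Finite sums of natural numbers

∑ : List A → (A → ℕ) → ℕ
∑ []       f = 0
∑ (x ∷ xs) f = f x + ∑ xs f

∑-++ : ∀ (xs ys : List A) f → ∑ (xs ++ ys) f ≡ ∑ xs f + ∑ ys f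
∑-++ []       ys f = refl
∑-++ (x ∷ xs) ys f = trans (cong (λ n → f x + n) (∑-++ xs ys f)) (sym (+-assoc (f x) _ _))

∑-map : ∀ (g : A → B) xs f → ∑ (map g xs) f ≡ ∑ xs (f ∘ g)
∑-map g []       f = refl
∑-map g (x ∷ xs) f = cong (λ n → f (g x) + n) (∑-map g xs f)

∑-concatMap : ∀ (g : A → List B) xs f → ∑ (concatMap g xs) f ≡ ∑ xs (λ x → ∑ (g x) f)
∑-concatMap g []       f = refl
∑-concatMap g (x ∷ xs) f =
  trans (∑-++ (g x) (concatMap g xs) f) (cong (λ n → ∑ (g x) f + n) (∑-concatMap g xs f))

∑-cong-∈ : ∀ (xs : List A) {f g} → (∀ {x} → x ∈ xs → f x ≡ g x) → ∑ xs f ≡ ∑ xs g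
∑-cong-∈ []       h = refl
∑-cong-∈ (x ∷ xs) h = cong₂ _+_ (h (here refl)) (∑-cong-∈ xs (h ∘ there))

∑-cong : ∀ (xs : List A) {f g} → (∀ x → f x ≡ g x) → ∑ xs f ≡ ∑ xs g
∑-cong xs h = ∑-cong-∈ xs (λ {x} _ → h x)

∑-+ : ∀ (xs : List A) f g → ∑ xs (λ x → f x + g x) ≡ ∑ xs f + ∑ xs g
∑-+ []       f g = refl
∑-+ (x ∷ xs) f g =
  trans (cong (λ n → f x + g x + n) (∑-+ xs f g)) (interchange (f x) (g x) (∑ xs f) (∑ xs g))

∑-mono : ∀ (xs : List A) {f g} → (∀ {x} → x ∈ xs → f x ≤ g x) → ∑ xs f ≤ ∑ xs g
∑-mono []       h = z≤n
∑-mono (x ∷ xs) h = +-mono-≤ (h (here refl)) (∑-mono xs (h ∘ there))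

∑-mono-< : ∀ {xs : List A} {f g y} → (∀ {x} → x ∈ xs → f x ≤ g x) → y ∈ xs → f y < g y →
           ∑ xs f < ∑ xs g
∑-mono-< {xs = x ∷ xs} h (here refl) lt = +-mono-<-≤ lt (∑-mono xs (h ∘ there))
∑-mono-< {xs = x ∷ xs} h (there y∈)  lt = +-mono-≤-< (h (here refl)) (∑-mono-< (h ∘ there) y∈ lt)

∑-zero : ∀ (xs : List A) {f} → (∀ {x} → x ∈ xs → f x ≡ 0) → ∑ xs f ≡ 0
∑-zero []       h = refl
∑-zero (x ∷ xs) h = cong₂ _+_ (h (here refl)) (∑-zero xs (h ∘ there))

∑-↭ : ∀ {xs ys : List A} f → xs ↭ ys → ∑ xs f ≡ ∑ ys f
∑-↭ f ↭refl           = refl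
∑-↭ f (prep x p)      = cong (λ n → f x + n) (∑-↭ f p)
∑-↭ f (↭swap x y p)   = trans (cong (λ z → f x + (f y + z)) (∑-↭ f p)) (x∙yz≈y∙xz (f x) (f y) _)
∑-↭ f (↭trans p q)    = trans (∑-↭ f p) (∑-↭ f q)

∑≡0⇒ : ∀ {xs : List A} {f} → ∑ xs f ≡ 0 → ∀ {x} → x ∈ xs → f x ≡ 0
∑≡0⇒ {xs = y ∷ xs} {f} eq (here refl) = m+n≡0⇒m≡0 (f y) eq
∑≡0⇒ {xs = y ∷ xs} {f} eq (there x∈)  = ∑≡0⇒ {xs = xs} (m+n≡0⇒n≡0 (f y) eq) x∈

when : Bool → ℕ → ℕ
when true  n = n
when false n = 0

∑-when : ∀ b (xs : List A) f → ∑ xs (λ x → when b (f x)) ≡ when b (∑ xs f)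
∑-when true  xs f = refl
∑-when false xs f = ∑-zero xs (λ _ → refl)

<⇒<ᵇ≡true : ∀ {m n} → m < n → (m <ᵇ n) ≡ true
<⇒<ᵇ≡true lt = Equivalence.to T-≡ (<⇒<ᵇ lt)

≮⇒<ᵇ≡false : ∀ {m n} → ¬ m < n → (m <ᵇ n) ≡ false
≮⇒<ᵇ≡false {m} {n} nlt with m <ᵇ n in eq
... | true  = ⊥-elim (nlt (<ᵇ⇒< m n (Equivalence.from T-≡ eq)))
... | false = refl

<ᵇ≡true⇒< : ∀ {m n} → (m <ᵇ n) ≡ true → m < n
<ᵇ≡true⇒< {m} {n} eq = <ᵇ⇒< m n (Equivalence.from T-≡ eq)

-- Pipe dreams, row by row

keep : ℕ → ℕ × List ℕ → ℕ × List ℕ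
keep c (k , s) = k , c ∷ s

cross : ℕ → ℕ × List ℕ → ℕ × List ℕ
cross z (k , s) = suc k , z ∷ s

-- One row of a pipe dream, read from left to right: c is the pipe being carried and every
-- unit of weight is a crossing at which c passes a smaller entry.
pass : ℕ → List ℕ → List (ℕ × List ℕ)
pass c []      = (0 , c ∷ []) ∷ []
pass c (z ∷ t) = map (keep c) (pass z t) ++ (if z <ᵇ c then map (cross z) (pass c t) else [])

addRow : ℕ → List ℕ × List ℕ → List (List ℕ × List ℕ)
addRow a (e , t) = map (λ (k , s) → k ∷ e , s) (pass a t)

-- Row i acts on the positions ≥ i, the last row first; a row of weights is recorded together
-- with the arrangement that is reached, and F w keeps the pairs whose arrangement is sorted.
rows : List ℕ → List (List ℕ × List ℕ)
rows []      = ([] , []) ∷ []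
rows (a ∷ w) = concatMap (addRow a) (rows w)

∑-pass : ∀ c z t φ → ∑ (pass c (z ∷ t)) φ ≡
  ∑ (pass z t) (φ ∘ keep c) + when (z <ᵇ c) (∑ (pass c t) (φ ∘ cross z))
∑-pass c z t φ =
  trans (∑-++ (map (keep c) (pass z t)) _ φ) (cong₂ _+_ (∑-map _ (pass z t) φ) (helper (z <ᵇ c)))
  where
  helper : ∀ b → ∑ (if b then map (cross z) (pass c t) else []) φ ≡
           when b (∑ (pass c t) (φ ∘ cross z))
  helper true  = ∑-map _ (pass c t) φ
  helper false = refl

∑-rows : ∀ a w φ → ∑ (rows (a ∷ w)) φ ≡
  ∑ (rows w) (λ (e , t) → ∑ (pass a t) (λ (k , s) → φ (k ∷ e , s)))
∑-rows a w φ =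
  trans (∑-concatMap (addRow a) (rows w) φ) (∑-cong (rows w) (λ (e , t) → ∑-map _ (pass a t) φ))

-- The lists `pass` and `rows` serve sums over all pipe dreams; the relations `Pass` and `Rows`
-- serve inductions along a single one.
data Pass : ℕ → List ℕ → ℕ → List ℕ → Set where
  end  : ∀ {c} → Pass c [] 0 (c ∷ [])
  emit : ∀ {c z t k s} → Pass z t k s → Pass c (z ∷ t) k (c ∷ s)
  jump : ∀ {c z t k s} → z < c → Pass c t k s → Pass c (z ∷ t) (suc k) (z ∷ s)

data Rows : List ℕ → List ℕ → List ℕ → Set where
  none : Rows [] [] []
  row  : ∀ {a w e t k s} → Rows w e t → Pass a t k s → Rows (a ∷ w) (k ∷ e) s

∈pass⇒Pass : ∀ {c} t {k s} → (k , s) ∈ pass c t → Pass c t k s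
∈pass⇒Pass [] (here refl) = end
∈pass⇒Pass {c} (z ∷ t) ks∈ with ∈-++⁻ (map (keep c) (pass z t)) ks∈
... | inj₁ p with _ , q , refl ← ∈-map⁻ (keep c) p = emit (∈pass⇒Pass t q)
... | inj₂ p with z <ᵇ c in eq
...   | true with _ , q , refl ← ∈-map⁻ (cross z) p = jump (<ᵇ≡true⇒< eq) (∈pass⇒Pass t q)

Pass⇒∈pass : ∀ {c t k s} → Pass c t k s → (k , s) ∈ pass c t
Pass⇒∈pass end = here refl
Pass⇒∈pass (emit p) = ∈-++⁺ˡ (∈-map⁺ (keep _) (Pass⇒∈pass p))
Pass⇒∈pass {c} {z ∷ t} {k} {s} (jump z<c p) = ∈-++⁺ʳ (map (keep c) (pass z t))
  (subst (λ b → (k , s) ∈ (if b then map (cross z) (pass c t) else []))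
    (sym (<⇒<ᵇ≡true z<c)) (∈-map⁺ (cross z) (Pass⇒∈pass p)))

∈rows⇒Rows : ∀ w {e s} → (e , s) ∈ rows w → Rows w e s
∈rows⇒Rows [] (here refl) = none
∈rows⇒Rows (a ∷ w) es∈
  with (e , t) , et∈ , q ← find (∈-concatMap⁻ (addRow a) {xs = rows w} es∈)
  with _ , r , refl ← ∈-map⁻ _ q = row (∈rows⇒Rows w et∈) (∈pass⇒Pass t r)

Rows⇒∈rows : ∀ {w e s} → Rows w e s → (e , s) ∈ rows w
Rows⇒∈rows none      = here refl
Rows⇒∈rows (row r p) = ∈-concatMap⁺ (addRow _) (lose (Rows⇒∈rows r) (∈-map⁺ _ (Pass⇒∈pass p)))

pass-↭ : ∀ {c t k s} → Pass c t k s → s ↭ c ∷ t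
pass-↭ end        = ↭-refl
pass-↭ (emit p)   = prep _ (pass-↭ p)
pass-↭ (jump _ p) = ↭trans (prep _ (pass-↭ p)) (↭swap _ _ ↭-refl)

rows-↭ : ∀ {w e s} → Rows w e s → s ↭ w
rows-↭ none      = ↭-refl
rows-↭ (row r p) = ↭trans (pass-↭ p) (prep _ (rows-↭ r))

Unique-resp-↭ : ∀ {xs ys : List ℕ} → xs ↭ ys → Unique xs → Unique ys
Unique-resp-↭ p = SetoidPerm.Unique-resp-↭ (setoid ℕ) (↭⇒↭ₛ p)

-- Exchanging two adjacent rows

-- Two consecutive rows with carried entries c and d, the row of d being performed first.
opaque
  twoRows : ℕ → ℕ → List ℕ → (ℕ → ℕ → List ℕ → ℕ) → ℕ
  twoRows c d t φ = ∑ (pass d t) (λ (l , t′) → ∑ (pass c t′) (λ (k , s) → φ k l s))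

  twoRows-def : ∀ c d t φ →
    ∑ (pass d t) (λ (l , t′) → ∑ (pass c t′) (λ (k , s) → φ k l s)) ≡ twoRows c d t φ
  twoRows-def c d t φ = refl

  twoRows-[] : ∀ c d φ → twoRows c d [] φ ≡
    φ 0 0 (c ∷ d ∷ []) + when (d <ᵇ c) (φ 1 0 (d ∷ c ∷ []))
  twoRows-[] c d φ with d <ᵇ c
  ... | true  = solve 2 (λ a b → (a :+ (b :+ con 0)) :+ con 0 := a :+ b) refl (φ 0 0 _) (φ 1 0 _)
  ... | false = +-identityʳ _

  -- Three entries c, d, z meet here; one is left behind and the other two are carried on by the two
  -- rows. The four summands are the possible choices, c being left behind in two ways.
  twoRows-∷ : ∀ c d z t φ → twoRows c d (z ∷ t) φ ≡
    (twoRows d z t (λ k l s → φ k l (c ∷ s)) +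
      when (d <ᵇ c) (twoRows c z t (λ k l s → φ (suc k) l (d ∷ s)))) +
    when (z <ᵇ d) (twoRows z d t (λ k l s → φ k (suc l) (c ∷ s)) +
      when (z <ᵇ c) (twoRows c d t (λ k l s → φ (suc k) (suc l) (z ∷ s))))
  twoRows-∷ c d z t φ = trans (∑-pass d z t _) (cong₂ _+_
    (trans (∑-cong (pass z t) (λ (l , t′) → ∑-pass c d t′ _))
      (trans (∑-+ (pass z t) _ _) (cong₂ _+_ refl (∑-when (d <ᵇ c) (pass z t) _))))
    (cong (when (z <ᵇ d)) (trans (∑-cong (pass d t) (λ (l , t′) → ∑-pass c z t′ _))
      (trans (∑-+ (pass d t) _ _) (cong₂ _+_ refl (∑-when (z <ᵇ c) (pass d t) _))))))

flipRows : (ℕ → ℕ → List ℕ → ℕ) → ℕ → ℕ → List ℕ → ℕ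
flipRows φ k l = φ l k

-- Needs a simultaneous induction with `twoRows-diff`: after one step the carried pair may be d, z
-- with z < d, where only the difference formula holds. The entry left behind and the weights
-- already spent are absorbed into φ.
twoRows-sym : ∀ {c d} t φ → Unique (c ∷ d ∷ t) → c < d →
  twoRows c d t φ ≡ twoRows c d t (flipRows φ)

-- This is twoRows c d t φ - twoRows c d t (flipRows φ) = (x - y) · twoRows d c t φ, where x and y
-- raise the first and the second argument of φ, with both sides moved to avoid subtraction.
twoRows-diff : ∀ {c d} t φ → Unique (c ∷ d ∷ t) → d < c →
  twoRows c d t φ + twoRows d c t (λ k l → φ k (suc l)) ≡
  twoRows c d t (flipRows φ) + twoRows d c t (λ k l → φ (suc k) l)

twoRows-sym {c} {d} [] φ _ c<d
  rewrite twoRows-[] c d φ | twoRows-[] c d (flipRows φ) | ≮⇒<ᵇ≡false (<⇒≯ c<d) = refl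
twoRows-sym {c} {d} (z ∷ t) φ ((c≢d ∷ c≢z ∷ c∉t) ∷ (d≢z ∷ d∉t) ∷ (z∉t ∷ ut)) c<d
  rewrite twoRows-∷ c d z t φ | twoRows-∷ c d z t (flipRows φ) | ≮⇒<ᵇ≡false (<⇒≯ c<d)
  with <-cmp d z
... | tri≈ _ d≡z _ = ⊥-elim (d≢z d≡z)
... | tri< d<z _ z≮d rewrite ≮⇒<ᵇ≡false z≮d =
  cong (λ n → (n + 0) + 0)
    (twoRows-sym t (λ k l s → φ k l (c ∷ s)) ((d≢z ∷ d∉t) ∷ z∉t ∷ ut) d<z)
-- `twoRows-diff` for the descent d, z leaves an increment of the first row; `twoRows-sym` for the
-- ascent z, d turns it into the flipped summand.
... | tri> _ _ z<d rewrite <⇒<ᵇ≡true z<d = combine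
    {a = twoRows d z t (λ k l s → φ k l (c ∷ s))} {a′ = twoRows d z t (λ k l s → φ l k (c ∷ s))}
    (twoRows-diff t (λ k l s → φ k l (c ∷ s)) ((d≢z ∷ d∉t) ∷ z∉t ∷ ut) z<d)
    (twoRows-sym t (λ k l s → φ (suc k) l (c ∷ s)) (((d≢z ∘ sym) ∷ z∉t) ∷ d∉t ∷ ut) z<d)
    (cong (when (z <ᵇ c))
      (twoRows-sym t (λ k l s → φ (suc k) (suc l) (z ∷ s)) ((c≢d ∷ c∉t) ∷ d∉t ∷ ut) c<d))
  where
  combine : ∀ {a b r a′ b′ b″ r′} → a + b ≡ a′ + b″ → b″ ≡ b′ → r ≡ r′ →
            (a + 0) + (b + r) ≡ (a′ + 0) + (b′ + r′)
  combine {a} {b} {r} {a′} {b′} p refl refl = trans (assoc a b) (trans (cong (_+ r) p) (sym (assoc a′ b′)))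
    where
    assoc : ∀ a b → (a + 0) + (b + r) ≡ (a + b) + r
    assoc a b = solve 3 (λ a b r → (a :+ con 0) :+ (b :+ r) := (a :+ b) :+ r) refl a b r

twoRows-diff {c} {d} [] φ _ d<c
  rewrite twoRows-[] c d φ | twoRows-[] c d (flipRows φ)
        | twoRows-[] d c (λ k l → φ k (suc l)) | twoRows-[] d c (λ k l → φ (suc k) l)
        | <⇒<ᵇ≡true d<c | ≮⇒<ᵇ≡false (<⇒≯ d<c) =
  solve 3 (λ a b c → (a :+ b) :+ (c :+ con 0) := (a :+ c) :+ (b :+ con 0)) refl (φ 0 0 _) (φ 1 0 _) (φ 0 1 _)
twoRows-diff {c} {d} (z ∷ t) φ ((c≢d ∷ c≢z ∷ c∉t) ∷ (d≢z ∷ d∉t) ∷ (z∉t ∷ ut)) d<c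
  rewrite twoRows-∷ c d z t φ | twoRows-∷ c d z t (flipRows φ)
        | twoRows-∷ d c z t (λ k l → φ k (suc l)) | twoRows-∷ d c z t (λ k l → φ (suc k) l)
        | <⇒<ᵇ≡true d<c | ≮⇒<ᵇ≡false (<⇒≯ d<c)
  with <-cmp c z
... | tri≈ _ c≡z _ = ⊥-elim (c≢z c≡z)
... | tri< c<z _ z≮c rewrite ≮⇒<ᵇ≡false z≮c | ≮⇒<ᵇ≡false (<⇒≯ (<-trans d<c c<z)) = combine
    (twoRows-sym t (λ k l s → φ k l (c ∷ s)) ((d≢z ∷ d∉t) ∷ z∉t ∷ ut) (<-trans d<c c<z))
    (twoRows-sym t (λ k l s → φ k (suc l) (d ∷ s)) ((c≢z ∷ c∉t) ∷ z∉t ∷ ut) c<z)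
  where
  combine : ∀ {a a′ b b′ e} → a ≡ a′ → e ≡ b′ →
            ((a + b) + 0) + ((e + 0) + 0) ≡ ((a′ + b′) + 0) + ((b + 0) + 0)
  combine {a} {_} {b} {b′} refl refl =
    solve 3 (λ a b e → ((a :+ b) :+ con 0) :+ ((e :+ con 0) :+ con 0)
                    := ((a :+ e) :+ con 0) :+ ((b :+ con 0) :+ con 0)) refl a b b′
... | tri> _ _ z<c rewrite <⇒<ᵇ≡true z<c with <-cmp d z
...   | tri≈ _ d≡z _ = ⊥-elim (d≢z d≡z)
...   | tri< d<z _ z≮d rewrite ≮⇒<ᵇ≡false z≮d = combine
    {a = twoRows d z t (λ k l s → φ k l (c ∷ s))} {b = twoRows c z t (λ k l s → φ (suc k) l (d ∷ s))}
    {b′ = twoRows c z t (λ k l s → φ l (suc k) (d ∷ s))} {e = twoRows c z t (λ k l s → φ k (suc l) (d ∷ s))}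
    (twoRows-sym t (λ k l s → φ k l (c ∷ s)) ((d≢z ∷ d∉t) ∷ z∉t ∷ ut) d<z)
    (twoRows-diff t (λ k l s → φ k (suc l) (d ∷ s)) ((c≢z ∷ c∉t) ∷ z∉t ∷ ut) z<c)
  where
  combine : ∀ {a a′ b b′ e g h} → a ≡ a′ → e + g ≡ b′ + h →
            ((a + b) + 0) + ((e + 0) + (g + 0)) ≡ ((a′ + b′) + 0) + ((b + 0) + (h + 0))
  combine {a} {_} {b} {b′} {e} {g} {h} refl p = trans
    (solve 4 (λ a b e g → ((a :+ b) :+ con 0) :+ ((e :+ con 0) :+ (g :+ con 0)) := (a :+ b) :+ (e :+ g))
      refl a b e g)
    (trans (cong (λ n → a + b + n) p)
      (solve 4 (λ a b b′ h → (a :+ b) :+ (b′ :+ h) := ((a :+ b′) :+ con 0) :+ ((b :+ con 0) :+ (h :+ con 0)))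
        refl a b b′ h))
-- For z < d < c each of the descents d z, c z and c d gives one difference formula, and the ascent
-- z d gives a symmetry.
...   | tri> _ _ z<d rewrite <⇒<ᵇ≡true z<d = combine
    {a = twoRows d z t (λ k l s → φ k l (c ∷ s))} {a′ = twoRows d z t (λ k l s → φ l k (c ∷ s))}
    {b = twoRows c z t (λ k l s → φ (suc k) l (d ∷ s))} {b′ = twoRows c z t (λ k l s → φ l (suc k) (d ∷ s))}
    {e = twoRows c z t (λ k l s → φ k (suc l) (d ∷ s))}
    {q = twoRows c d t (λ k l s → φ (suc k) (suc l) (z ∷ s))} {q′ = twoRows c d t (λ k l s → φ (suc l) (suc k) (z ∷ s))}
    (twoRows-diff t (λ k l s → φ k l (c ∷ s)) ((d≢z ∷ d∉t) ∷ z∉t ∷ ut) z<d)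
    (twoRows-sym t (λ k l s → φ (suc k) l (c ∷ s)) (((d≢z ∘ sym) ∷ z∉t) ∷ d∉t ∷ ut) z<d)
    (twoRows-diff t (λ k l s → φ k (suc l) (d ∷ s)) ((c≢z ∷ c∉t) ∷ z∉t ∷ ut) z<c)
    (twoRows-diff t (λ k l s → φ (suc k) (suc l) (z ∷ s)) ((c≢d ∷ c∉t) ∷ d∉t ∷ ut) d<c)
  where
  combine : ∀ {a a′ b b′ e g h p p′ p″ q q′ r r′} →
            a + p ≡ a′ + p″ → p″ ≡ p′ → e + g ≡ b′ + h → q + r ≡ q′ + r′ →
            ((a + b) + (p + q)) + ((e + 0) + (g + r)) ≡ ((a′ + b′) + (p′ + q′)) + ((b + 0) + (h + r′))
  combine {a} {a′} {b} {b′} {e} {g} {h} {p} {p′} {_} {q} {q′} {r} {r′} i refl j k = trans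
    (solve 7 (λ a b e g p q r → ((a :+ b) :+ (p :+ q)) :+ ((e :+ con 0) :+ (g :+ r))
       := b :+ ((a :+ p) :+ ((e :+ g) :+ (q :+ r)))) refl a b e g p q r)
    (trans (cong (λ n → b + n) (cong₂ _+_ i (cong₂ _+_ j k)))
      (solve 7 (λ a b b′ h p q r → b :+ ((a :+ p) :+ ((b′ :+ h) :+ (q :+ r)))
         := ((a :+ b′) :+ (p :+ q)) :+ ((b :+ con 0) :+ (h :+ r))) refl a′ b b′ h p′ q′ r′))

-- Ascents, descents and row exchanges inside a whole pipe dream

data Adjacent (R : ℕ → ℕ → Set) : ℕ → List ℕ → Set where
  here  : ∀ {a b w} → R a b → Adjacent R zero (a ∷ b ∷ w)
  there : ∀ {i a w} → Adjacent R i w → Adjacent R (suc i) (a ∷ w)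

Ascent Descent : ℕ → List ℕ → Set
Ascent  = Adjacent _<_
Descent = Adjacent _>_

adjacent : ∀ {R} i w → suc i < length w → R (at w i) (at w (suc i)) → Adjacent R i w
adjacent zero    (a ∷ b ∷ w) _         r = here r
adjacent zero    (a ∷ [])    (s≤s ())  r
adjacent (suc i) (a ∷ w)     (s≤s i<)  r = there (adjacent i w i< r)

adjacent⁻ : ∀ {R i w} → Adjacent R i w → suc i < length w × R (at w i) (at w (suc i))
adjacent⁻ (here r)  = s≤s (s≤s z≤n) , r
adjacent⁻ (there p) = s≤s (proj₁ (adjacent⁻ p)) , proj₂ (adjacent⁻ p)

adjacent-swap : ∀ {R i w} → Adjacent R i w → Adjacent (λ a b → R b a) i (swapAt i w)
adjacent-swap (here r)  = here r
adjacent-swap (there p) = there (adjacent-swap p)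

swapAt-involutive : ∀ i w → swapAt i (swapAt i w) ≡ w
swapAt-involutive zero    []          = refl
swapAt-involutive zero    (a ∷ [])    = refl
swapAt-involutive zero    (a ∷ b ∷ w) = refl
swapAt-involutive (suc i) []          = refl
swapAt-involutive (suc i) (a ∷ w)     = cong (a ∷_) (swapAt-involutive i w)

swapAt-↭ : ∀ i w → swapAt i w ↭ w
swapAt-↭ zero    []          = ↭-refl
swapAt-↭ zero    (a ∷ [])    = ↭-refl
swapAt-↭ zero    (a ∷ b ∷ w) = ↭swap b a ↭-refl
swapAt-↭ (suc i) []          = ↭-refl
swapAt-↭ (suc i) (a ∷ w)     = prep a (swapAt-↭ i w)

incAt : ℕ → List ℕ → List ℕ
incAt i       []      = []
incAt zero    (k ∷ e) = suc k ∷ e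
incAt (suc i) (k ∷ e) = k ∷ incAt i e

∑-twoRows : ∀ c d w φ → ∑ (rows (c ∷ d ∷ w)) φ ≡
  ∑ (rows w) (λ (e , t) → twoRows c d t (λ k l s → φ (k ∷ l ∷ e , s)))
∑-twoRows c d w φ = trans (∑-rows c (d ∷ w) φ) (trans (∑-rows d w _)
  (∑-cong (rows w) (λ (e , t) → twoRows-def c d t _)))

twoRows-Unique : ∀ {c d w e t} → Unique (c ∷ d ∷ w) → (e , t) ∈ rows w → Unique (c ∷ d ∷ t)
twoRows-Unique u et∈ = Unique-resp-↭ (prep _ (prep _ (↭-sym (rows-↭ (∈rows⇒Rows _ et∈))))) u

-- The rows after the exchanged pair have already been performed and only supply the word t; the
-- rows before it are absorbed into φ. Hence a weight φ on all pairs, not only on sorted outcomes.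
rows-sym : ∀ {i w} φ → Unique w → Ascent i w →
  ∑ (rows w) φ ≡ ∑ (rows w) (λ (e , s) → φ (swapAt i e , s))
rows-sym {w = c ∷ d ∷ w} φ u (here c<d) = trans (∑-twoRows c d w φ)
  (trans (∑-cong-∈ (rows w) (λ {(e , t)} et∈ →
      twoRows-sym t (λ k l s → φ (k ∷ l ∷ e , s)) (twoRows-Unique u et∈) c<d))
    (sym (∑-twoRows c d w _)))
rows-sym {suc i} {a ∷ w} φ (_ ∷ u) (there p) = trans (∑-rows a w φ)
  (trans (rows-sym (λ (e , t) → ∑ (pass a t) (λ (k , s) → φ (k ∷ e , s))) u p)
    (sym (∑-rows a w _)))

rows-diff : ∀ {i w} φ → Unique w → Descent i w →
  ∑ (rows w) φ + ∑ (rows (swapAt i w)) (λ (e , s) → φ (incAt (suc i) e , s)) ≡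
  ∑ (rows w) (λ (e , s) → φ (swapAt i e , s)) + ∑ (rows (swapAt i w)) (λ (e , s) → φ (incAt i e , s))
rows-diff {w = c ∷ d ∷ w} φ u (here d<c) =
  trans (cong₂ _+_ (∑-twoRows c d w φ) (∑-twoRows d c w _))
    (trans (sym (∑-+ (rows w) _ _))
      (trans (∑-cong-∈ (rows w) (λ {(e , t)} et∈ →
          twoRows-diff t (λ k l s → φ (k ∷ l ∷ e , s)) (twoRows-Unique u et∈) d<c))
        (trans (∑-+ (rows w) _ _)
          (sym (cong₂ _+_ (∑-twoRows c d w _) (∑-twoRows d c w _))))))
rows-diff {suc i} {a ∷ w} φ (_ ∷ u) (there p) =
  trans (cong₂ _+_ (∑-rows a w φ) (∑-rows a (swapAt i w) _))
    (trans (rows-diff (λ (e , t) → ∑ (pass a t) (λ (k , s) → φ (k ∷ e , s))) u p)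
      (sym (cong₂ _+_ (∑-rows a w _) (∑-rows a (swapAt i w) _))))

-- Sortedness and the Lehmer code

_<all_ : ℕ → List ℕ → Bool
c <all []      = true
c <all (z ∷ t) = (c <ᵇ z) ∧ (c <all t)

sorted : List ℕ → Bool
sorted []      = true
sorted (c ∷ t) = (c <all t) ∧ sorted t

smaller : ℕ → List ℕ → ℕ
smaller a t = ∑ t (λ z → when (z <ᵇ a) 1)

code : List ℕ → List ℕ
code []      = []
code (a ∷ w) = smaller a w ∷ code w

<all⁺ : ∀ {c t} → All (c <_) t → (c <all t) ≡ true
<all⁺ []       = refl
<all⁺ (p ∷ ps) rewrite <⇒<ᵇ≡true p = <all⁺ ps

<all⁻ : ∀ {c} t → (c <all t) ≡ true → All (c <_) t
<all⁻         []      _ = []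
<all⁻ {c} (z ∷ t) p with c <ᵇ z in eq
... | true = <ᵇ≡true⇒< eq ∷ <all⁻ t p

<all-↭ : ∀ {c s t} → s ↭ t → (c <all s) ≡ (c <all t)
<all-↭ {c} {s} {t} p with c <all s in eqs | c <all t in eqt
... | true  | true  = refl
... | false | false = refl
... | true  | false = trans (sym (<all⁺ (All-resp-↭ p (<all⁻ s eqs)))) eqt
... | false | true  = trans (sym eqs) (<all⁺ (All-resp-↭ (↭-sym p) (<all⁻ t eqt)))

sorted⁻ : ∀ s → sorted s ≡ true → AllPairs _<_ s
sorted⁻ []      _ = []
sorted⁻ (c ∷ s) p with c <all s in eq
... | true = <all⁻ s eq ∷ sorted⁻ s p

sorted⁺ : ∀ {s} → AllPairs _<_ s → sorted s ≡ true
sorted⁺ []       = refl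
sorted⁺ (p ∷ ps) rewrite <all⁺ p = sorted⁺ ps

smaller≡0 : ∀ {c t} → All (c <_) t → smaller c t ≡ 0
smaller≡0 []       = refl
smaller≡0 (p ∷ ps) rewrite ≮⇒<ᵇ≡false (<⇒≯ p) = smaller≡0 ps

-- Dominant words

noInversion⇒< : ∀ {c z t} → All (z ≢_) t → All (c <_) t → All (λ y → ¬ (c < y × y < z)) t →
  All (z <_) t
noInversion⇒< []          []         []       = []
noInversion⇒< (z≢y ∷ z≢) (c<y ∷ c<) (p ∷ ps) =
  ≤∧≢⇒< (≮⇒≥ (λ y<z → p (c<y , y<z))) z≢y ∷ noInversion⇒< z≢ c< ps

-- A pass only permutes c ∷ t, so whether a lies below its outcome is known before the pass.
∑-pass-cons : ∀ a c t (g : ℕ → ℕ) b → (a <all (c ∷ t)) ≡ b →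
  ∑ (pass c t) (λ (k , s) → when (sorted (a ∷ s)) (g k)) ≡
  when b (∑ (pass c t) (λ (k , s) → when (sorted s) (g k)))
∑-pass-cons a c t g b refl =
  trans (∑-cong-∈ (pass c t) (λ {(k , s)} ks∈ →
      trans (cong (λ b → when (b ∧ sorted s) (g k)) (<all-↭ (pass-↭ (∈pass⇒Pass t ks∈))))
        (when-∧ (a <all (c ∷ t)) (sorted s) (g k))))
    (∑-when (a <all (c ∷ t)) (pass c t) _)
  where
  when-∧ : ∀ b b′ n → when (b ∧ b′) n ≡ when b (when b′ n)
  when-∧ true  b′ n = refl
  when-∧ false b′ n = refl

-- If t has no inversion above c, only the sorted t can be completed to a sorted result by a
-- pass of c, and then in exactly one way.
∑-pass-sorted : ∀ c t (g : ℕ → ℕ) → Unique (c ∷ t) → AllPairs (λ x y → ¬ (c < y × y < x)) t →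
  ∑ (pass c t) (λ (k , s) → when (sorted s) (g k)) ≡ when (sorted t) (g (smaller c t))
∑-pass-sorted c []      g _ _ = +-identityʳ (g 0)
∑-pass-sorted c (z ∷ t) g ((c≢z ∷ c≢t) ∷ (z≢t ∷ ut)) (p ∷ ps)
  rewrite ∑-pass c z t (λ (k , s) → when (sorted s) (g k))
  with c <all (z ∷ t) in eq
-- With c below everything, absence of inversions above c puts z below all of t; nothing can be
-- crossed, and both counts are 0.
... | true with c<z ∷ c<t ← <all⁻ (z ∷ t) eq
  rewrite ∑-pass-cons c z t g true eq | ≮⇒<ᵇ≡false (<⇒≯ c<z) = begin
    ∑ (pass z t) (λ (k , s) → when (sorted s) (g k)) + 0
      ≡⟨ +-identityʳ _ ⟩
    ∑ (pass z t) (λ (k , s) → when (sorted s) (g k))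
      ≡⟨ ∑-pass-sorted z t g (z≢t ∷ ut)
           (AllPairs.map (λ ¬q (z<y , y<x) → ¬q (<-trans c<z z<y , y<x)) ps) ⟩
    when (sorted t) (g (smaller z t))
      ≡⟨ cong (λ n → when (sorted t) (g n)) (trans (smaller≡0 z<t) (sym (smaller≡0 c<t))) ⟩
    when (sorted t) (g (smaller c t))
      ≡⟨ cong (λ b → when (b ∧ sorted t) (g (smaller c t))) (sym (<all⁺ z<t)) ⟩
    when (sorted (z ∷ t)) (g (smaller c t)) ∎
  where
  open ≡-Reasoning
  z<t = noInversion⇒< z≢t c<t p
-- Something smaller than c lies to its right, so emitting c now can never end sorted; only a
-- crossing over z can contribute.
... | false rewrite ∑-pass-cons c z t g false eq with <-cmp z c
...   | tri≈ _ z≡c _ = ⊥-elim (c≢z (sym z≡c))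
...   | tri> z≮c _ c<z rewrite ≮⇒<ᵇ≡false z≮c with z <all t in eq′
...     | false = refl
...     | true with () ← trans (sym eq) (<all⁺ (c<z ∷ All.map (<-trans c<z) (<all⁻ t eq′)))
∑-pass-sorted c (z ∷ t) g ((c≢z ∷ c≢t) ∷ (z≢t ∷ ut)) (p ∷ ps) | false | tri< z<c _ _
  rewrite <⇒<ᵇ≡true z<c with z <all t in eq′
... | false = ∑-pass-cons z c t (g ∘ suc) false (cong₂ _∧_ (<⇒<ᵇ≡true z<c) eq′)
... | true  = trans (∑-pass-cons z c t (g ∘ suc) true (cong₂ _∧_ (<⇒<ᵇ≡true z<c) eq′))
  (∑-pass-sorted c t (g ∘ suc) (c≢t ∷ ut) ps)

module _ {R : ℕ → ℕ → Set} (R-< : ∀ {x y} → x < y → R x y) where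

  -- A crossing makes an inverted pair increasing and changes no other relative order, so every
  -- relation that contains < survives.
  pass-AllPairs : ∀ {c t k s} → Pass c t k s → AllPairs R (c ∷ t) → AllPairs R s
  pass-AllPairs end ps = ps
  pass-AllPairs (emit p) (q ∷ ps) = All-resp-↭ (↭-sym (pass-↭ p)) q ∷ pass-AllPairs p ps
  pass-AllPairs (jump z<c p) ((_ ∷ q) ∷ (q′ ∷ ps)) =
    All-resp-↭ (↭-sym (pass-↭ p)) (R-< z<c ∷ q′) ∷ pass-AllPairs p (q ∷ ps)

  rows-AllPairs : ∀ {w e s} → Rows w e s → AllPairs R w → AllPairs R s
  rows-AllPairs none      _        = []
  rows-AllPairs (row r p) (q ∷ ps) =
    pass-AllPairs p (All-resp-↭ (↭-sym (rows-↭ r)) q ∷ rows-AllPairs r ps)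

-- The classical name of the 132-avoiding permutations. The condition is split by the entry that
-- plays the 1, as this is the entry carried by a row.
data Dominant : List ℕ → Set where
  []  : Dominant []
  _∷_ : ∀ {a w} → AllPairs (λ x y → ¬ (a < y × y < x)) w → Dominant w → Dominant (a ∷ w)

-- The rows of w create no inversion above a, so `∑-pass-sorted` evaluates the row of a and leaves
-- the same kind of sum for w.
∑-dominant : ∀ {w} (g : List ℕ → ℕ) → Unique w → Dominant w →
  ∑ (rows w) (λ (e , s) → when (sorted s) (g e)) ≡ g (code w)
∑-dominant g _ [] = +-identityʳ (g [])
∑-dominant {a ∷ w} g (a≢w ∷ u) (av ∷ d) = trans (∑-rows a w _)
  (trans (∑-cong-∈ (rows w) (λ {(e , t)} et∈ →
      let r = ∈rows⇒Rows w et∈; w↭t = ↭-sym (rows-↭ r) in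
      trans (∑-pass-sorted a t (λ k → g (k ∷ e)) (Unique-resp-↭ (prep a w↭t) (a≢w ∷ u))
              (rows-AllPairs (λ x<y (_ , y<x) → <⇒≯ x<y y<x) r av))
        (cong (λ n → when (sorted t) (g (n ∷ e))) (∑-↭ _ (rows-↭ r)))))
    (∑-dominant (λ e → g (smaller a w ∷ e)) u d))

-- Laurent polynomials

infix 4 _~_
-- Equality up to trailing zeros, which is what `sameExp` decides.
record _~_ (α β : Exp) : Set where
  constructor pointwise
  field expAt≡ : ∀ j → expAt α j ≡ expAt β j
open _~_

~-sym : ∀ {α β} → α ~ β → β ~ α
~-sym p = pointwise (λ j → sym (expAt≡ p j))

~-trans : ∀ {α β γ} → α ~ β → β ~ γ → α ~ γ
~-trans p q = pointwise (λ j → trans (expAt≡ p j) (expAt≡ q j))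

isYes-true : ∀ {a b : ℤ} → a ≡ b → ⌊ a ℤ.≟ b ⌋ ≡ true
isYes-true {a} {b} a≡b with a ℤ.≟ b
... | yes _  = refl
... | no a≢b = ⊥-elim (a≢b a≡b)

isYes⇒≡ : ∀ (a b : ℤ) → ⌊ a ℤ.≟ b ⌋ ≡ true → a ≡ b
isYes⇒≡ a b p with a ℤ.≟ b
... | yes a≡b = a≡b

∧⁻ : ∀ {b b′} → b ∧ b′ ≡ true → b ≡ true × b′ ≡ true
∧⁻ {true} {true} _ = refl , refl

sameExp⁺ : ∀ α β → (∀ j → expAt α j ≡ expAt β j) → sameExp α β ≡ true
sameExp⁺ []      []      p = refl
sameExp⁺ []      (b ∷ β) p = cong₂ _∧_ (isYes-true (sym (p 0))) (sameExp⁺ [] β (p ∘ suc))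
sameExp⁺ (a ∷ α) []      p = cong₂ _∧_ (isYes-true (p 0)) (sameExp⁺ α [] (p ∘ suc))
sameExp⁺ (a ∷ α) (b ∷ β) p = cong₂ _∧_ (isYes-true (p 0)) (sameExp⁺ α β (p ∘ suc))

sameExp⁻ : ∀ α β → sameExp α β ≡ true → ∀ j → expAt α j ≡ expAt β j
sameExp⁻ []      []      p j       = refl
sameExp⁻ []      (b ∷ β) p zero    = sym (isYes⇒≡ b (+ 0) (proj₁ (∧⁻ p)))
sameExp⁻ []      (b ∷ β) p (suc j) = sameExp⁻ [] β (proj₂ (∧⁻ {isZero b} p)) j
sameExp⁻ (a ∷ α) []      p zero    = isYes⇒≡ a (+ 0) (proj₁ (∧⁻ p))
sameExp⁻ (a ∷ α) []      p (suc j) = sameExp⁻ α [] (proj₂ (∧⁻ {isZero a} p)) j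
sameExp⁻ (a ∷ α) (b ∷ β) p zero    = isYes⇒≡ a b (proj₁ (∧⁻ p))
sameExp⁻ (a ∷ α) (b ∷ β) p (suc j) = sameExp⁻ α β (proj₂ (∧⁻ {⌊ a ℤ.≟ b ⌋} p)) j

sameExp-cong : ∀ {α β α′ β′} → (α ~ β → α′ ~ β′) → (α′ ~ β′ → α ~ β) →
  sameExp α β ≡ sameExp α′ β′
sameExp-cong {α} {β} {α′} {β′} f g with sameExp α β in eq | sameExp α′ β′ in eq′
... | true  | true  = refl
... | false | false = refl
... | true  | false = trans (sym (sameExp⁺ α′ β′ (expAt≡ (f (pointwise (sameExp⁻ α β eq)))))) eq′
... | false | true  = trans (sym eq) (sameExp⁺ α β (expAt≡ (g (pointwise (sameExp⁻ α′ β′ eq′)))))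

if-cong : ∀ {b b′} {c : ℤ} → b ≡ b′ → (if b then c else + 0) ≡ (if b′ then c else + 0)
if-cong refl = refl

coeff-~ : ∀ P {α β} → α ~ β → coeff P α ≡ coeff P β
coeff-~ []            p = refl
coeff-~ ((c , e) ∷ P) p = cong₂ ℤ._+_
  (if-cong (sameExp-cong {e} (λ q → ~-trans q p) (λ q → ~-trans q (~-sym p)))) (coeff-~ P p)

coeff-++ : ∀ P Q α → coeff (P ++ Q) α ≡ coeff P α ℤ.+ coeff Q α
coeff-++ []            Q α = sym (ℤₚ.+-identityˡ _)
coeff-++ ((c , e) ∷ P) Q α = trans (cong (λ z → m ℤ.+ z) (coeff-++ P Q α))
  (sym (ℤₚ.+-assoc m (coeff P α) (coeff Q α)))
  where m = if sameExp e α then c else + 0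

coeff-negP : ∀ P α → coeff (negP P) α ≡ ℤ.- coeff P α
coeff-negP []            α = refl
coeff-negP ((c , e) ∷ P) α = trans (cong₂ ℤ._+_ (helper (sameExp e α)) (coeff-negP P α))
  (sym (ℤₚ.neg-distrib-+ (if sameExp e α then c else + 0) (coeff P α)))
  where
  helper : ∀ b → (if b then ℤ.- c else + 0) ≡ ℤ.- (if b then c else + 0)
  helper true  = refl
  helper false = refl

coeff-⊖ : ∀ P Q α → coeff (P ⊖ Q) α ≡ coeff P α ℤ.- coeff Q α
coeff-⊖ P Q α = trans (coeff-++ P (negP Q) α) (cong (λ z → coeff P α ℤ.+ z) (coeff-negP Q α))

-- A monomial factor translates coefficients; α′ plays the part of α - e, determined only up to
-- trailing zeros.
coeff-⊗-term : ∀ c e Q {α α′} → (∀ f → sameExp (addExp e f) α ≡ sameExp f α′) →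
  coeff (((c , e) ∷ []) ⊗ Q) α ≡ c ℤ.* coeff Q α′
coeff-⊗-term c e []            h = sym (ℤₚ.*-zeroʳ c)
coeff-⊗-term c e ((d , f) ∷ Q) {α} {α′} h = trans
  (cong₂ ℤ._+_ (trans (if-cong (h f)) (helper (sameExp f α′))) (coeff-⊗-term c e Q h))
  (sym (ℤₚ.*-distribˡ-+ c _ (coeff Q α′)))
  where
  helper : ∀ b → (if b then c ℤ.* d else + 0) ≡ c ℤ.* (if b then d else + 0)
  helper true  = refl
  helper false = sym (ℤₚ.*-zeroʳ c)

coeff-⊗-∷ : ∀ t P Q α → coeff ((t ∷ P) ⊗ Q) α ≡ coeff ((t ∷ []) ⊗ Q) α ℤ.+ coeff (P ⊗ Q) α
coeff-⊗-∷ t P Q α = trans (cong (λ R → coeff R α) (split t P Q)) (coeff-++ ((t ∷ []) ⊗ Q) (P ⊗ Q) α)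
  where
  split : ∀ t P Q → (t ∷ P) ⊗ Q ≡ ((t ∷ []) ⊗ Q) ++ (P ⊗ Q)
  split (c , e) P Q = cong (_++ (P ⊗ Q)) (sym (++-identityʳ _))

expAt-addExp : ∀ α β j → expAt (addExp α β) j ≡ expAt α j ℤ.+ expAt β j
expAt-addExp []      β       j       = sym (ℤₚ.+-identityˡ _)
expAt-addExp (a ∷ α) []      j       = sym (ℤₚ.+-identityʳ _)
expAt-addExp (a ∷ α) (b ∷ β) zero    = refl
expAt-addExp (a ∷ α) (b ∷ β) (suc j) = expAt-addExp α β j

unit : ℕ → ℤ → Exp
unit k z = replicate k (+ 0) ++ (z ∷ [])

expAt-unit-≡ : ∀ k z → expAt (unit k z) k ≡ z
expAt-unit-≡ zero    z = refl
expAt-unit-≡ (suc k) z = expAt-unit-≡ k z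

expAt-unit-≢ : ∀ k z {j} → j ≢ k → expAt (unit k z) j ≡ + 0
expAt-unit-≢ zero    z {zero}  j≢k = ⊥-elim (j≢k refl)
expAt-unit-≢ zero    z {suc j} j≢k = refl
expAt-unit-≢ (suc k) z {zero}  j≢k = refl
expAt-unit-≢ (suc k) z {suc j} j≢k = expAt-unit-≢ k z (j≢k ∘ cong suc)

inc dec : ℕ → Exp → Exp
inc k = addExp (unit k (+ 1))
dec k = addExp (unit k (ℤ.- + 1))

expAt-unit-cancel : ∀ k j → expAt (unit k (ℤ.- + 1)) j ℤ.+ expAt (unit k (+ 1)) j ≡ + 0
expAt-unit-cancel k j with j ℕ.≟ k
... | yes refl = cong₂ ℤ._+_ (expAt-unit-≡ k (ℤ.- + 1)) (expAt-unit-≡ k (+ 1))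
... | no j≢k   = cong₂ ℤ._+_ (expAt-unit-≢ k _ j≢k) (expAt-unit-≢ k _ j≢k)

dec-inc : ∀ k α → dec k (inc k α) ~ α
dec-inc k α = pointwise λ j → let u = expAt (unit k (ℤ.- + 1)) j; v = expAt (unit k (+ 1)) j in begin
  expAt (dec k (inc k α)) j       ≡⟨ expAt-addExp (unit k _) (inc k α) j ⟩
  u ℤ.+ expAt (inc k α) j         ≡⟨ cong (λ z → u ℤ.+ z) (expAt-addExp (unit k _) α j) ⟩
  u ℤ.+ (v ℤ.+ expAt α j)         ≡⟨ sym (ℤₚ.+-assoc u v _) ⟩
  (u ℤ.+ v) ℤ.+ expAt α j         ≡⟨ cong (ℤ._+ expAt α j) (expAt-unit-cancel k j) ⟩
  + 0 ℤ.+ expAt α j               ≡⟨ ℤₚ.+-identityˡ _ ⟩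
  expAt α j ∎
  where open ≡-Reasoning

inc-dec : ∀ k α → inc k (dec k α) ~ α
inc-dec k α = pointwise λ j → let u = expAt (unit k (ℤ.- + 1)) j; v = expAt (unit k (+ 1)) j in begin
  expAt (inc k (dec k α)) j       ≡⟨ expAt-addExp (unit k _) (dec k α) j ⟩
  v ℤ.+ expAt (dec k α) j         ≡⟨ cong (λ z → v ℤ.+ z) (expAt-addExp (unit k _) α j) ⟩
  v ℤ.+ (u ℤ.+ expAt α j)         ≡⟨ sym (ℤₚ.+-assoc v u _) ⟩
  (v ℤ.+ u) ℤ.+ expAt α j         ≡⟨ cong (ℤ._+ expAt α j) (trans (ℤₚ.+-comm v u) (expAt-unit-cancel k j)) ⟩
  + 0 ℤ.+ expAt α j               ≡⟨ ℤₚ.+-identityˡ _ ⟩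
  expAt α j ∎
  where open ≡-Reasoning

addExp-cong : ∀ γ {α β} → α ~ β → addExp γ α ~ addExp γ β
addExp-cong γ {α} {β} p = pointwise λ j → trans (expAt-addExp γ α j)
  (trans (cong (λ z → expAt γ j ℤ.+ z) (expAt≡ p j)) (sym (expAt-addExp γ β j)))

sameExp-inc : ∀ k e α → sameExp (inc k e) α ≡ sameExp e (dec k α)
sameExp-inc k e α = sameExp-cong
  (λ p → ~-trans (~-sym (dec-inc k e)) (addExp-cong (unit k _) p))
  (λ p → ~-trans (addExp-cong (unit k _) p) (inc-dec k α))

coeff-∂ : ∀ k P α → coeff ((var k ⊖ var (suc k)) ⊗ P) α ≡ coeff P (dec k α) ℤ.- coeff P (dec (suc k) α)
coeff-∂ k P α = trans (coeff-⊗-∷ (+ 1 , unit k (+ 1)) ((ℤ.- + 1 , unit (suc k) (+ 1)) ∷ []) P α)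
  (cong₂ ℤ._+_
    (trans (coeff-⊗-term (+ 1) (unit k (+ 1)) P (λ f → sameExp-inc k f α)) (ℤₚ.*-identityˡ _))
    (trans (coeff-⊗-term (ℤ.- + 1) (unit (suc k) (+ 1)) P (λ f → sameExp-inc (suc k) f α)) (ℤₚ.-1*i≡-i _)))

expAt-map-applyUpTo : ∀ (f : ℕ → ℤ) g {n j} → j < n → expAt (map f (applyUpTo g n)) j ≡ f (g j)
expAt-map-applyUpTo f g {suc n} {zero}  _         = refl
expAt-map-applyUpTo f g {suc n} {suc j} (s≤s j<n) = expAt-map-applyUpTo f (g ∘ suc) j<n

expAt-map-applyUpTo-≥ : ∀ (f : ℕ → ℤ) g {n j} → n ≤ j → expAt (map f (applyUpTo g n)) j ≡ + 0
expAt-map-applyUpTo-≥ f g {zero}          _         = refl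
expAt-map-applyUpTo-≥ f g {suc n} {suc j} (s≤s n≤j) = expAt-map-applyUpTo-≥ f (g ∘ suc) n≤j

expAt-≥ : ∀ e {j} → length e ≤ j → expAt e j ≡ + 0
expAt-≥ []              _       = refl
expAt-≥ (a ∷ e) {suc j} (s≤s l) = expAt-≥ e l

swapIdx-here : ∀ k → swapIdx k k ≡ suc k
swapIdx-here k with k ℕ.≟ k | k ℕ.≟ suc k
... | yes _  | _ = refl
... | no k≢k | _ = ⊥-elim (k≢k refl)

swapIdx-next : ∀ k → swapIdx k (suc k) ≡ k
swapIdx-next k with suc k ℕ.≟ k | suc k ℕ.≟ suc k
... | yes e | _     = ⊥-elim (1+n≢n e)
... | no _  | yes _ = refl
... | no _  | no ne = ⊥-elim (ne refl)

swapIdx-other : ∀ {k j} → j ≢ k → j ≢ suc k → swapIdx k j ≡ j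
swapIdx-other {k} {j} p q with j ℕ.≟ k | j ℕ.≟ suc k
... | yes e | _     = ⊥-elim (p e)
... | no _  | yes e = ⊥-elim (q e)
... | no _  | no _  = refl

swapIdx-involutive : ∀ k j → swapIdx k (swapIdx k j) ≡ j
swapIdx-involutive k j with j ℕ.≟ k | j ℕ.≟ suc k
... | yes refl | _        = swapIdx-next k
... | no _     | yes refl = swapIdx-here k
... | no p     | no q     = swapIdx-other p q

swapIdx-suc : ∀ k j → swapIdx (suc k) (suc j) ≡ suc (swapIdx k j)
swapIdx-suc k j with j ℕ.≟ k | j ℕ.≟ suc k
... | yes refl | _        = swapIdx-here (suc k)
... | no _     | yes refl = swapIdx-next (suc k)
... | no p     | no q     = swapIdx-other (p ∘ suc-injective) (q ∘ suc-injective)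

expAt-swapExp : ∀ k e j → expAt (swapExp k e) j ≡ expAt e (swapIdx k j)
expAt-swapExp k e j with j <? length e ⊔ suc (suc k)
... | yes j< = expAt-map-applyUpTo _ id j<
... | no j≮ = trans (expAt-map-applyUpTo-≥ _ id j≥)
  (sym (trans (cong (expAt e) (swapIdx-other (≢-sym (<⇒≢ (<-trans (n<1+n k) k+1<j))) (≢-sym (<⇒≢ k+1<j))))
    (expAt-≥ e (m⊔n≤o⇒m≤o (length e) _ j≥))))
  where
  j≥ = ≮⇒≥ j≮
  k+1<j : suc k < j
  k+1<j = m⊔n≤o⇒n≤o (length e) (suc (suc k)) j≥

swapExp-~ : ∀ k {α β} → swapExp k α ~ β → α ~ swapExp k β
swapExp-~ k {α} {β} p = pointwise λ j → begin
  expAt α j                         ≡⟨ cong (expAt α) (sym (swapIdx-involutive k j)) ⟩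
  expAt α (swapIdx k (swapIdx k j)) ≡⟨ sym (expAt-swapExp k α (swapIdx k j)) ⟩
  expAt (swapExp k α) (swapIdx k j) ≡⟨ expAt≡ p (swapIdx k j) ⟩
  expAt β (swapIdx k j)             ≡⟨ sym (expAt-swapExp k β j) ⟩
  expAt (swapExp k β) j ∎
  where open ≡-Reasoning

sameExp-swapExp : ∀ k e α → sameExp (swapExp k e) α ≡ sameExp e (swapExp k α)
sameExp-swapExp k e α = sameExp-cong {α′ = e} (swapExp-~ k) (λ p → ~-sym (swapExp-~ k (~-sym p)))

coeff-sP : ∀ k P α → coeff (sP k P) α ≡ coeff P (swapExp k α)
coeff-sP k []            α = refl
coeff-sP k ((c , e) ∷ P) α = cong₂ ℤ._+_ (if-cong (sameExp-swapExp k e α)) (coeff-sP k P α)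

δ : ℕ → Exp
δ n = map (λ j → + (n ∸ suc j)) (upTo n)

-- The exponent of x^δ x^α after inverting the first n variables in x^α. Entries from n on are kept,
-- because `invSub n` does not touch those variables.
complementExp : ℕ → Exp → Exp
complementExp n α = addExp (δ n) (negFirst n α)

expAt-negFirst-< : ∀ {n j} α → j < n → expAt (negFirst n α) j ≡ ℤ.- expAt α j
expAt-negFirst-< {suc n} []      j<n               = refl
expAt-negFirst-< {suc n} {zero}  (a ∷ α) j<n       = refl
expAt-negFirst-< {suc n} {suc j} (a ∷ α) (s≤s j<n) = expAt-negFirst-< α j<n

expAt-negFirst-≥ : ∀ {n j} α → n ≤ j → expAt (negFirst n α) j ≡ expAt α j
expAt-negFirst-≥ {zero}          α       _         = refl
expAt-negFirst-≥ {suc n}         []      _         = refl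
expAt-negFirst-≥ {suc n} {suc j} (a ∷ α) (s≤s n≤j) = expAt-negFirst-≥ α n≤j

expAt-complement-< : ∀ {n j} α → j < n → expAt (complementExp n α) j ≡ + (n ∸ suc j) ℤ.- expAt α j
expAt-complement-< {n} {j} α j<n = trans (expAt-addExp (δ n) (negFirst n α) j)
  (cong₂ ℤ._+_ (expAt-map-applyUpTo _ id j<n) (expAt-negFirst-< α j<n))

expAt-complement-≥ : ∀ {n j} α → n ≤ j → expAt (complementExp n α) j ≡ expAt α j
expAt-complement-≥ {n} {j} α n≤j = trans (expAt-addExp (δ n) (negFirst n α) j)
  (trans (cong₂ ℤ._+_ (expAt-map-applyUpTo-≥ _ id n≤j) (expAt-negFirst-≥ α n≤j)) (ℤₚ.+-identityˡ _))

complement-~ : ∀ n {α β} → complementExp n α ~ β → α ~ complementExp n β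
complement-~ n {α} {β} (pointwise p) = pointwise go
  where
  go : ∀ j → expAt α j ≡ expAt (complementExp n β) j
  go j with j <? n
  ... | yes j<n = sym (begin
    expAt (complementExp n β) j ≡⟨ expAt-complement-< β j<n ⟩
    d ℤ.- expAt β j             ≡⟨ cong (λ z → d ℤ.- z) (trans (sym (p j)) (expAt-complement-< α j<n)) ⟩
    d ℤ.- (d ℤ.- expAt α j)     ≡⟨ solveℤ 2 (λ d a → d ⊟ (d ⊟ a) ⊜ a) refl d (expAt α j) ⟩
    expAt α j ∎)
    where
    open ≡-Reasoning
    d = + (n ∸ suc j)
  ... | no j≮n = trans (sym (expAt-complement-≥ α (≮⇒≥ j≮n)))
    (trans (p j) (sym (expAt-complement-≥ β (≮⇒≥ j≮n))))

sameExp-complement : ∀ n e α → sameExp (complementExp n e) α ≡ sameExp e (complementExp n α)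
sameExp-complement n e α = sameExp-cong (complement-~ n) (λ p → ~-sym (complement-~ n (~-sym p)))

complement-involutive : ∀ n α → complementExp n (complementExp n α) ~ α
complement-involutive n α = ~-sym (complement-~ n (pointwise (λ _ → refl)))

coeff-complement : ∀ n P α → coeff (xδ n ⊗ invSub n P) α ≡ coeff P (complementExp n α)
coeff-complement n []            α = refl
coeff-complement n ((c , e) ∷ P) α = cong₂ ℤ._+_
  (trans (if-cong (sameExp-complement n e α)) (cong (λ d → if _ then d else + 0) (ℤₚ.*-identityˡ c)))
  (coeff-complement n P α)

-- The exponent of x^α x_{k+1} / x_{k+2}. A product (x_{k+1} - x_{k+2}) P vanishes exactly when the
-- coefficients of P are constant along `step`.
step : ℕ → Exp → Exp
step k α = dec (suc k) (inc k α)

expAt-step : ∀ k α → expAt (step k α) k ≡ ℤ.suc (expAt α k)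
expAt-step k α = trans (expAt-addExp (unit (suc k) _) (inc k α) k)
  (trans (cong (ℤ._+ expAt (inc k α) k) (expAt-unit-≢ (suc k) _ (≢-sym 1+n≢n)))
    (trans (ℤₚ.+-identityˡ _) (trans (expAt-addExp (unit k _) α k)
      (cong (ℤ._+ expAt α k) (expAt-unit-≡ k _)))))

bound : ℕ → Poly → ℕ
bound k []            = 0
bound k ((c , e) ∷ P) = suc ∣ expAt e k ∣ ⊔ bound k P

coeff-beyond : ∀ k P α → + bound k P ℤ.≤ expAt α k → coeff P α ≡ + 0
coeff-beyond k []            α p = refl
coeff-beyond k ((c , e) ∷ P) α p with sameExp e α in eq
... | false = trans (ℤₚ.+-identityˡ _) (coeff-beyond k P α
        (ℤₚ.≤-trans (ℤ.+≤+ (m≤n⊔m (suc ∣ expAt e k ∣) (bound k P))) p))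
... | true = ⊥-elim (<⇒≱ {∣ expAt e k ∣} ≤-refl (ℤ.drop‿+≤+ (ℤₚ.≤-trans
        (ℤ.+≤+ (m≤m⊔n (suc ∣ expAt e k ∣) (bound k P)))
        (ℤₚ.≤-trans p (ℤₚ.≤-trans (ℤₚ.≤-reflexive (sym (sameExp⁻ e α eq k))) (i≤∣i∣ (expAt e k)))))))
  where
  i≤∣i∣ : ∀ i → i ℤ.≤ + ∣ i ∣
  i≤∣i∣ (+ n)    = ℤₚ.≤-refl
  i≤∣i∣ -[1+ n ] = ℤ.-≤+

-- Every step raises one exponent by 1, and only finitely many exponents occur in P.
step-invariant⇒0 : ∀ k P → (∀ α → coeff P α ≡ coeff P (step k α)) → ∀ α → coeff P α ≡ + 0
-- The absolute value pays for a negative starting exponent, `bound` for leaving the support.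
step-invariant⇒0 k P h α = go (bound k P ℕ.+ ∣ expAt α k ∣) α (below (expAt α k))
  where
  below : ∀ i → + bound k P ℤ.≤ i ℤ.+ + (bound k P ℕ.+ ∣ i ∣)
  below (+ n) = ℤ.+≤+ (≤-trans (m≤m+n (bound k P) n) (m≤n+m _ n))
  below -[1+ n ] = ℤₚ.≤-reflexive (sym (trans
    (cong (λ z → -[1+ n ] ℤ.+ z) (ℤₚ.pos-+ (bound k P) (suc n)))
    (solveℤ 2 (λ b m → ⊟ m ⊞ (b ⊞ m) ⊜ b) refl (+ bound k P) (+ suc n))))
  go : ∀ N α → + bound k P ℤ.≤ expAt α k ℤ.+ + N → coeff P α ≡ + 0
  go zero    α p = coeff-beyond k P α (subst (_ ℤ.≤_) (ℤₚ.+-identityʳ _) p)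
  go (suc N) α p = trans (h α) (go N (step k α) (subst (_ ℤ.≤_)
    (trans (solveℤ 2 (λ a m → a ⊞ (conℤ (+ 1) ⊞ m) ⊜ (conℤ (+ 1) ⊞ a) ⊞ m) refl (expAt α k) (+ N))
      (cong (ℤ._+ + N) (sym (expAt-step k α)))) p))

-- Injectivity of multiplication by x_{k+1} - x_{k+2}, read on coefficients.
cancel-∂ : ∀ k P Q → (∀ α → coeff P (dec k α) ℤ.- coeff P (dec (suc k) α) ≡
                           coeff Q (dec k α) ℤ.- coeff Q (dec (suc k) α)) → P ≈ Q
cancel-∂ k P Q h α = ℤₚ.i-j≡0⇒i≡j (coeff P α) (coeff Q α)
  (trans (sym (coeff-⊖ P Q α)) (step-invariant⇒0 k (P ⊖ Q) inv α))
  where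
  inv : ∀ α → coeff (P ⊖ Q) α ≡ coeff (P ⊖ Q) (step k α)
  inv α = trans (coeff-⊖ P Q α) (trans eq (sym (coeff-⊖ P Q (step k α))))
    where
    p = coeff P α ; q = coeff Q α
    p′ = coeff P (step k α) ; q′ = coeff Q (step k α)
    h′ : p ℤ.- p′ ≡ q ℤ.- q′
    h′ = trans (cong (ℤ._- p′) (coeff-~ P (~-sym (dec-inc k α))))
      (trans (h (inc k α)) (cong (ℤ._- q′) (coeff-~ Q (dec-inc k α))))
    eq : p ℤ.- q ≡ p′ ℤ.- q′
    eq = trans (solveℤ 3 (λ p q p′ → p ⊟ q ⊜ (p ⊟ p′) ⊞ (p′ ⊟ q)) refl p q p′)
      (trans (cong (ℤ._+ (p′ ℤ.- q)) h′)
        (solveℤ 3 (λ q p′ q′ → (q ⊟ q′) ⊞ (p′ ⊟ q) ⊜ p′ ⊟ q′) refl q p′ q′))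

-- The polynomial of a word

F : List ℕ → Poly
F w = map (λ (e , s) → (if sorted s then + 1 else + 0) , map +_ e) (rows w)

hit : List ℕ → Exp → ℕ
hit e α = when (sameExp (map +_ e) α) 1

weight : Exp → List ℕ × List ℕ → ℕ
weight α (e , s) = when (sorted s) (hit e α)

coeff-F : ∀ w α → coeff (F w) α ≡ + ∑ (rows w) (weight α)
coeff-F w α = go (rows w)
  where
  term : ∀ b b′ → (if b then (if b′ then + 1 else + 0) else + 0) ≡ + when b′ (when b 1)
  term true  true  = refl
  term true  false = refl
  term false true  = refl
  term false false = refl
  go : ∀ ps → coeff (map (λ (e , s) → (if sorted s then + 1 else + 0) , map +_ e) ps) α
              ≡ + ∑ ps (weight α)
  go []             = refl
  go ((e , s) ∷ ps) = cong₂ ℤ._+_ (term (sameExp (map +_ e) α) (sorted s)) (go ps)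

rows-length : ∀ {w e s} → Rows w e s → length e ≡ length w
rows-length none      = refl
rows-length (row r p) = cong suc (rows-length r)

expAt-map-swapAt : ∀ i e j → suc i < length e →
  expAt (map +_ (swapAt i e)) j ≡ expAt (map +_ e) (swapIdx i j)
expAt-map-swapAt zero    (a ∷ b ∷ e) zero          _       = refl
expAt-map-swapAt zero    (a ∷ b ∷ e) (suc zero)    _       = refl
expAt-map-swapAt zero    (a ∷ b ∷ e) (suc (suc j)) _       = refl
expAt-map-swapAt zero    (a ∷ [])    j             (s≤s ())
expAt-map-swapAt (suc i) (a ∷ e)     zero          _       = refl
expAt-map-swapAt (suc i) (a ∷ e)     (suc j)       (s≤s l) =
  trans (expAt-map-swapAt i e j l) (cong (expAt (map +_ (a ∷ e))) (sym (swapIdx-suc i j)))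

hit-swapAt : ∀ i e α → suc i < length e → hit (swapAt i e) α ≡ hit e (swapExp i α)
hit-swapAt i e α l = cong (λ b → when b 1) (trans
  (sameExp-cong {map +_ (swapAt i e)} {α} {swapExp i (map +_ e)} (~-trans (~-sym eq)) (~-trans eq))
  (sameExp-swapExp i (map +_ e) α))
  where
  eq : map +_ (swapAt i e) ~ swapExp i (map +_ e)
  eq = pointwise λ j → trans (expAt-map-swapAt i e j l) (sym (expAt-swapExp i (map +_ e) j))

map-incAt : ∀ i e → i < length e → map +_ (incAt i e) ≡ inc i (map +_ e)
map-incAt zero    (k ∷ e) _       = refl
map-incAt (suc i) (k ∷ e) (s≤s l) = cong (+ k ∷_) (map-incAt i e l)

hit-incAt : ∀ i e α → i < length e → hit (incAt i e) α ≡ hit e (dec i α)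
hit-incAt i e α l = cong (λ b → when b 1)
  (trans (cong (λ ε → sameExp ε α) (map-incAt i e l)) (sameExp-inc i (map +_ e) α))

weight-cong : ∀ w (f : List ℕ → List ℕ) {α β} →
  (∀ e → length e ≡ length w → hit (f e) α ≡ hit e β) →
  ∑ (rows w) (λ (e , s) → weight α (f e , s)) ≡ ∑ (rows w) (weight β)
weight-cong w f h = ∑-cong-∈ (rows w) (λ {(e , s)} es∈ →
  cong (when (sorted s)) (h e (rows-length (∈rows⇒Rows w es∈))))

F-sym : ∀ {i w} → Unique w → Ascent i w → ∀ α → coeff (F w) α ≡ coeff (F w) (swapExp i α)
F-sym {i} {w} u p α = begin
  coeff (F w) α                   ≡⟨ coeff-F w α ⟩
  + ∑ (rows w) (weight α)         ≡⟨ cong +_ (rows-sym (weight α) u p) ⟩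
  + ∑ (rows w) (λ (e , s) → weight α (swapAt i e , s))
    ≡⟨ cong +_ (weight-cong w (swapAt i) (λ e l → hit-swapAt i e α
         (subst (suc i <_) (sym l) (proj₁ (adjacent⁻ p))))) ⟩
  + ∑ (rows w) (weight (swapExp i α)) ≡⟨ sym (coeff-F w _) ⟩
  coeff (F w) (swapExp i α) ∎
  where open ≡-Reasoning

-- With f = F w and g = F (w s_i) this is (x_i - x_{i+1}) g = f - s_i f, read at α. `rows-diff`
-- states it over ℕ with terms moved across; `transpose` restores the differences.
F-∂ : ∀ {i w} → Unique w → Descent i w → ∀ α →
  coeff (F (swapAt i w)) (dec i α) ℤ.- coeff (F (swapAt i w)) (dec (suc i) α) ≡
  coeff (F w) α ℤ.- coeff (F w) (swapExp i α)
F-∂ {i} {w} u p α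
  rewrite coeff-F (swapAt i w) (dec i α) | coeff-F (swapAt i w) (dec (suc i) α)
        | coeff-F w α | coeff-F w (swapExp i α) =
  transpose (∑ (rows w) (weight α)) (∑ (rows w) (weight (swapExp i α)))
    (∑ (rows v) (weight (dec i α))) (∑ (rows v) (weight (dec (suc i) α))) (begin
    ∑ (rows w) (weight α) + ∑ (rows v) (weight (dec (suc i) α))
      ≡⟨ cong (λ m → ∑ (rows w) (weight α) + m) (sym (weight-cong v (incAt (suc i))
           (λ e l → hit-incAt (suc i) e α (subst (suc i <_) (sym l) lv)))) ⟩
    ∑ (rows w) (weight α) + ∑ (rows v) (λ (e , s) → weight α (incAt (suc i) e , s))
      ≡⟨ rows-diff (weight α) u p ⟩
    ∑ (rows w) (λ (e , s) → weight α (swapAt i e , s)) + ∑ (rows v) (λ (e , s) → weight α (incAt i e , s))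
      ≡⟨ cong₂ _+_
           (weight-cong w (swapAt i) (λ e l → hit-swapAt i e α (subst (suc i <_) (sym l) (proj₁ (adjacent⁻ p)))))
           (weight-cong v (incAt i) (λ e l → hit-incAt i e α (subst (i <_) (sym l) (<-trans (n<1+n i) lv)))) ⟩
    ∑ (rows w) (weight (swapExp i α)) + ∑ (rows v) (weight (dec i α)) ∎)
  where
  open ≡-Reasoning
  v = swapAt i w
  lv : suc i < length v
  lv = proj₁ (adjacent⁻ (adjacent-swap p))
  transpose : ∀ a b c d → a + d ≡ b + c → + c ℤ.- + d ≡ + a ℤ.- + b
  transpose a b c d eq = trans
    (solveℤ 3 (λ b c d → c ⊟ d ⊜ (b ⊞ c) ⊟ (d ⊞ b)) refl (+ b) (+ c) (+ d))
    (trans (cong (ℤ._- (+ d ℤ.+ + b)) (trans (sym (ℤₚ.pos-+ b c)) (trans (cong +_ (sym eq)) (ℤₚ.pos-+ a d))))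
      (solveℤ 3 (λ a b d → (a ⊞ d) ⊟ (d ⊞ b) ⊜ a ⊟ b) refl (+ a) (+ b) (+ d)))

F-dominant : ∀ {w} → Unique w → Dominant w → ∀ α → coeff (F w) α ≡ + hit (code w) α
F-dominant {w} u d α = trans (coeff-F w α) (cong +_ (∑-dominant (λ e → hit e α) u d))

-- The longest element

smaller-> : ∀ {a t} → All (a >_) t → smaller a t ≡ length t
smaller-> []       = refl
smaller-> (p ∷ ps) rewrite <⇒<ᵇ≡true p = cong suc (smaller-> ps)

code-decreasing : ∀ {w} → AllPairs _>_ w → ∀ j → expAt (map +_ (code w)) j ≡ + (length w ∸ suc j)
code-decreasing []       j       = refl
code-decreasing (p ∷ ps) zero    = cong +_ (smaller-> p)
code-decreasing (p ∷ ps) (suc j) = code-decreasing ps j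

decreasing⇒dominant : ∀ {w} → AllPairs _>_ w → Dominant w
decreasing⇒dominant []                 = []
decreasing⇒dominant {a ∷ w} (p ∷ ps) = below p ∷ decreasing⇒dominant ps
  where
  below : ∀ {t} → All (a >_) t → AllPairs (λ x y → ¬ (a < y × y < x)) t
  below []       = []
  below (q ∷ qs) = All.map (λ y<a (a<y , _) → <⇒≯ a<y y<a) qs ∷ below qs

range-increasing : ∀ n → AllPairs _<_ (range n)
range-increasing n = AllPairsₚ.map⁺ (AllPairsₚ.applyUpTo⁺₁ id n (λ i<j _ → s≤s i<j))

w₀-decreasing : ∀ n → AllPairs _>_ (w₀ n)
w₀-decreasing n = subst (AllPairs _>_)
  (sym (trans (cong reverse (map-applyUpTo id suc n)) (reverse-applyUpTo suc n)))
  (AllPairsₚ.applyDownFrom⁺₁ suc n (λ j<i _ → s≤s j<i))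

w₀-perm : ∀ n → IsPerm n (w₀ n)
w₀-perm n = ↭-reverse (range n)

length-range : ∀ n → length (range n) ≡ n
length-range n = trans (length-map suc (upTo n)) (length-upTo n)

perm-length : ∀ {n w} → IsPerm n w → length w ≡ n
perm-length {n} p = trans (↭-length p) (length-range n)

perm-Unique : ∀ {n w} → IsPerm n w → Unique w
perm-Unique {n} p = Unique-resp-↭ (↭-sym p) (AllPairs.map <⇒≢ (range-increasing n))

monomial-≈ : ∀ {α β} → α ~ β → ∀ γ → coeff ((+ 1 , α) ∷ []) γ ≡ coeff ((+ 1 , β) ∷ []) γ
monomial-≈ {α} {β} p γ = cong (ℤ._+ + 0)
  (if-cong (sameExp-cong {α} {γ} {β} (~-trans (~-sym p)) (~-trans p)))

coeff-monomial : ∀ e α → + hit e α ≡ coeff ((+ 1 , map +_ e) ∷ []) α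
coeff-monomial e α with sameExp (map +_ e) α
... | true  = refl
... | false = refl

-- A decreasing word is dominant and its code is δ_n, so only one monomial occurs.
F-w₀ : ∀ n → F (w₀ n) ≈ xδ n
F-w₀ n α = trans (F-dominant (perm-Unique (w₀-perm n)) (decreasing⇒dominant dec₀) α)
  (trans (coeff-monomial (code (w₀ n)) α) (monomial-≈ {map +_ (code (w₀ n))} {δ n} (pointwise exps) α))
  where
  dec₀ = w₀-decreasing n
  exps : ∀ j → expAt (map +_ (code (w₀ n))) j ≡ expAt (δ n) j
  exps j with j <? n
  ... | yes j<n = trans (code-decreasing dec₀ j) (trans (cong (λ m → + (m ∸ suc j)) (perm-length (w₀-perm n)))
          (sym (expAt-map-applyUpTo _ id j<n)))
  ... | no j≮n = trans (code-decreasing dec₀ j) (trans (cong (λ m → + (m ∸ suc j)) (perm-length (w₀-perm n)))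
          (trans (cong +_ (m≤n⇒m∸n≡0 (m≤n⇒m≤1+n (≮⇒≥ j≮n)))) (sym (expAt-map-applyUpTo-≥ _ id (≮⇒≥ j≮n)))))

-- Agreement with the recursive definition of Schubert polynomials

-- Both P and F w solve the same equation (x_i - x_{i+1}) g = f - s_i f, whichever i the derivation
-- chose, and `cancel-∂` makes the solution unique.
Schubert⇒F : ∀ {n w P} → Schubert n w P → IsPerm n w × P ≈ F w
Schubert⇒F {n} (longest P≈) = w₀-perm n , λ α → trans (P≈ α) (sym (F-w₀ n α))
Schubert⇒F {n} {w} {P} (divided {Q = Q} k k<n lt S eq) = perm , cancel-∂ k P (F w) λ α → begin
  coeff P (dec k α) ℤ.- coeff P (dec (suc k) α)   ≡⟨ sym (coeff-∂ k P α) ⟩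
  coeff ((var k ⊖ var (suc k)) ⊗ P) α             ≡⟨ eq α ⟩
  coeff (Q ⊖ sP k Q) α                            ≡⟨ coeff-⊖ Q (sP k Q) α ⟩
  coeff Q α ℤ.- coeff (sP k Q) α
    ≡⟨ cong₂ ℤ._-_ (Q≈ α) (trans (coeff-sP k Q α) (Q≈ (swapExp k α))) ⟩
  coeff (F v) α ℤ.- coeff (F v) (swapExp k α)
    ≡⟨ sym (F-∂ (perm-Unique (proj₁ IH)) (adjacent-swap asc) α) ⟩
  coeff (F (swapAt k v)) (dec k α) ℤ.- coeff (F (swapAt k v)) (dec (suc k) α)
    ≡⟨ cong (λ u → coeff (F u) (dec k α) ℤ.- coeff (F u) (dec (suc k) α)) (swapAt-involutive k w) ⟩
  coeff (F w) (dec k α) ℤ.- coeff (F w) (dec (suc k) α) ∎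
  where
  open ≡-Reasoning
  v = swapAt k w
  IH = Schubert⇒F S
  Q≈ = proj₂ IH
  perm : IsPerm n w
  perm = ↭trans (↭-sym (swapAt-↭ k w)) (proj₁ IH)
  asc : Ascent k w
  asc = adjacent k w (subst (suc k <_) (sym (perm-length perm)) k<n) lt

inv : List ℕ → ℕ
inv []      = 0
inv (a ∷ w) = smaller a w + inv w

inv-ascent : ∀ {i w} → Ascent i w → inv (swapAt i w) ≡ suc (inv w)
inv-ascent {w = c ∷ d ∷ w} (here c<d) rewrite <⇒<ᵇ≡true c<d | ≮⇒<ᵇ≡false (<⇒≯ c<d) =
  cong suc (x∙yz≈y∙xz (smaller d w) (smaller c w) (inv w))
inv-ascent {suc i} {a ∷ w} (there p) = trans
  (cong₂ _+_ (∑-↭ _ (swapAt-↭ i w)) (inv-ascent p)) (+-suc (smaller a w) (inv w))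

smaller-≤ : ∀ a w → smaller a w ≤ length w
smaller-≤ a []      = z≤n
smaller-≤ a (z ∷ w) with z <ᵇ a
... | true  = s≤s (smaller-≤ a w)
... | false = m≤n⇒m≤1+n (smaller-≤ a w)

inv-≤ : ∀ w → inv w ≤ length w * length w
inv-≤ []      = z≤n
inv-≤ (a ∷ w) = +-mono-≤ (m≤n⇒m≤1+n (smaller-≤ a w))
  (≤-trans (inv-≤ w) (*-monoʳ-≤ (length w) (n≤1+n (length w))))

ascent-or-decreasing : ∀ w → Unique w → (∃ λ i → Ascent i w) ⊎ AllPairs _>_ w
ascent-or-decreasing []          _ = inj₂ []
ascent-or-decreasing (a ∷ [])    _ = inj₂ ([] ∷ [])
ascent-or-decreasing (a ∷ b ∷ w) ((a≢b ∷ _) ∷ u) with ascent-or-decreasing (b ∷ w) u | <-cmp a b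
... | inj₁ (i , p) | _                = inj₁ (suc i , there p)
... | inj₂ _       | tri< a<b _ _     = inj₁ (0 , here a<b)
... | inj₂ _       | tri≈ _ a≡b _     = ⊥-elim (a≢b a≡b)
... | inj₂ (q ∷ d) | tri> _ _ b<a     = inj₂ ((b<a ∷ All.map (λ y<b → <-trans y<b b<a) q) ∷ q ∷ d)

decreasing-↭⇒≡ : ∀ {xs ys} → AllPairs _>_ xs → AllPairs _>_ ys → xs ↭ ys → xs ≡ ys
decreasing-↭⇒≡ {_} {[]}     _        _        p = ↭-empty-inv p
decreasing-↭⇒≡ {[]} {y ∷ ys} _       _        p with () ← ↭-empty-inv (↭-sym p)
decreasing-↭⇒≡ {x ∷ xs} {y ∷ ys} (q ∷ d) (q′ ∷ d′) p
  with ∈-resp-↭ p (here refl) | ∈-resp-↭ (↭-sym p) (here refl)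
... | here refl | _         = cong (x ∷_) (decreasing-↭⇒≡ d d′ (drop-∷ p))
... | there _   | here refl = cong (x ∷_) (decreasing-↭⇒≡ d d′ (drop-∷ p))
... | there x∈  | there y∈  = ⊥-elim (<⇒≯ (All.lookup q′ x∈) (All.lookup q y∈))

-- Exchanging an ascent adds one inversion, and a permutation without ascents is w₀. N bounds the
-- exchanges still to come; n * n is a crude bound on the inversions.
F-Schubert : ∀ {n w} → IsPerm n w → Schubert n w (F w)
F-Schubert {n} {w} perm = go (n * n) w perm (m≤m+n (n * n) (inv w))
  where
  go : ∀ N w → IsPerm n w → n * n ≤ N + inv w → Schubert n w (F w)
  go N w perm le with ascent-or-decreasing w (perm-Unique perm)
  ... | inj₂ d = subst (λ v → Schubert n v (F v))
          (decreasing-↭⇒≡ (w₀-decreasing n) d (↭trans (w₀-perm n) (↭-sym perm))) (longest (F-w₀ n))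
  ... | inj₁ (k , asc) with N
  ...   | zero = ⊥-elim (<⇒≱ {n * n} (≤-trans (s≤s le) (≤-reflexive (sym (inv-ascent asc))))
            (≤-trans (inv-≤ (swapAt k w)) (≤-reflexive (cong (λ m → m * m) (perm-length perm′)))))
    where
    perm′ : IsPerm n (swapAt k w)
    perm′ = ↭trans (swapAt-↭ k w) perm
  ...   | suc N = divided k (subst (suc k <_) (perm-length perm) (proj₁ (adjacent⁻ asc)))
            (proj₂ (adjacent⁻ asc))
            (go N v perm′ (≤-trans le (≤-reflexive (trans (sym (+-suc N (inv w))) (cong (λ m → N + m) (sym (inv-ascent asc)))))))
            eq
    where
    v = swapAt k w
    perm′ : IsPerm n v
    perm′ = ↭trans (swapAt-↭ k w) perm
    eq : (var k ⊖ var (suc k)) ⊗ F w ≈ F v ⊖ sP k (F v)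
    eq α = trans (coeff-∂ k (F w) α) (trans
      (subst (λ u → coeff (F u) (dec k α) ℤ.- coeff (F u) (dec (suc k) α) ≡ coeff (F v) α ℤ.- coeff (F v) (swapExp k α))
        (swapAt-involutive k w) (F-∂ (perm-Unique perm′) (adjacent-swap asc) α))
      (sym (trans (coeff-⊖ (F v) (sP k (F v)) α) (cong (λ z → coeff (F v) α ℤ.- z) (coeff-sP k (F v) α)))))

-- The lowest exponent: prefix sums bounded by inversions

pre : ℕ → List ℕ → ℕ
pre zero    e       = 0
pre (suc i) []      = 0
pre (suc i) (k ∷ e) = k + pre i e

pre-suc : ∀ i e → pre (suc i) e ≡ pre i e + at e i
pre-suc zero    []      = refl
pre-suc zero    (k ∷ e) = +-identityʳ k
pre-suc (suc i) []      = refl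
pre-suc (suc i) (k ∷ e) = trans (cong (λ m → k + m) (pre-suc i e)) (sym (+-assoc k (pre i e) (at e i)))

smaller-∷-< : ∀ {z c} t → z < c → smaller c (z ∷ t) ≡ suc (smaller c t)
smaller-∷-< t z<c rewrite <⇒<ᵇ≡true z<c = refl

smaller-∷-≮ : ∀ {z c} t → ¬ z < c → smaller c (z ∷ t) ≡ smaller c t
smaller-∷-≮ t z≮c rewrite ≮⇒<ᵇ≡false z≮c = refl

-- A crossing exchanges two neighbours in the wrong order and so removes exactly one inversion; an
-- emission removes none.
pass-inv : ∀ {c t k s} → Pass c t k s → k + inv s ≡ inv (c ∷ t)
pass-inv end = refl
pass-inv {c} {z ∷ t} {k} {_ ∷ s} (emit p) = trans (x∙yz≈y∙xz k (smaller c s) (inv s))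
  (cong₂ _+_ (∑-↭ _ (pass-↭ p)) (pass-inv p))
pass-inv {c} {z ∷ t} {suc k} {_ ∷ s} (jump z<c p) = begin
  suc k + (smaller z s + inv s)                   ≡⟨ cong suc (x∙yz≈y∙xz k (smaller z s) (inv s)) ⟩
  suc (smaller z s + (k + inv s))                 ≡⟨ cong suc (cong₂ _+_ (∑-↭ _ (pass-↭ p)) (pass-inv p)) ⟩
  suc (smaller z (c ∷ t) + (smaller c t + inv t)) ≡⟨ cong (λ m → suc (m + _)) (smaller-∷-≮ t (<⇒≯ z<c)) ⟩
  suc (smaller z t + (smaller c t + inv t))       ≡⟨ cong suc (x∙yz≈y∙xz (smaller z t) (smaller c t) (inv t)) ⟩
  suc (smaller c t) + (smaller z t + inv t)       ≡⟨ cong (_+ (smaller z t + inv t)) (sym (smaller-∷-< t z<c)) ⟩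
  inv (c ∷ z ∷ t) ∎
  where open ≡-Reasoning

-- The inversions whose left end is among the first i positions of w survive all later rows; the
-- first i rows remove them or leave them in s.
rows-bottom : ∀ i {w e s} → Rows w e s → pre i (code w) ≤ pre i e + inv s
rows-bottom zero    _    = z≤n
rows-bottom (suc i) none = z≤n
rows-bottom (suc i) {a ∷ w} {k ∷ e} {s} (row {t = t} r p) = begin
  smaller a w + pre i (code w)      ≤⟨ +-monoʳ-≤ (smaller a w) (rows-bottom i r) ⟩
  smaller a w + (pre i e + inv t)   ≡⟨ cong (_+ (pre i e + inv t)) (∑-↭ _ (↭-sym (rows-↭ r))) ⟩
  smaller a t + (pre i e + inv t)   ≡⟨ x∙yz≈y∙xz (smaller a t) (pre i e) (inv t) ⟩
  pre i e + inv (a ∷ t)             ≡⟨ cong (λ m → pre i e + m) (sym (pass-inv p)) ⟩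
  pre i e + (k + inv s)             ≡⟨ x∙yz≈y∙xz (pre i e) k (inv s) ⟩
  k + (pre i e + inv s)             ≡⟨ sym (+-assoc k (pre i e) (inv s)) ⟩
  k + pre i e + inv s ∎
  where open ≤-Reasoning

inv-increasing : ∀ {s} → AllPairs _<_ s → inv s ≡ 0
inv-increasing []       = refl
inv-increasing (p ∷ ps) = cong₂ _+_ (smaller≡0 p) (inv-increasing ps)

Path : List ℕ → List ℕ → Set
Path w e = ∃ λ s → Rows w e s × AllPairs _<_ s

path-bottom : ∀ {w e} → Path w e → ∀ i → pre i (code w) ≤ pre i e
path-bottom (s , r , inc) i = ≤-trans (rows-bottom i r)
  (≤-reflexive (trans (cong (λ m → pre i _ + m) (inv-increasing inc)) (+-identityʳ _)))

pass-emit : ∀ c t → Pass c t 0 (c ∷ t)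
pass-emit c []      = end
pass-emit c (z ∷ t) = emit (pass-emit z t)

pass-insert : ∀ {c t} → Unique (c ∷ t) → AllPairs _<_ t →
  ∃ λ s → Pass c t (smaller c t) s × AllPairs _<_ s
pass-insert _ [] = _ , end , [] ∷ []
pass-insert {c} {z ∷ t} ((c≢z ∷ c≢t) ∷ (_ ∷ u)) (z<t ∷ inc) with <-cmp z c
... | tri≈ _ z≡c _ = ⊥-elim (c≢z (sym z≡c))
... | tri< z<c _ _ with s , p , inc′ ← pass-insert (c≢t ∷ u) inc =
  z ∷ s , subst (λ k → Pass c (z ∷ t) k (z ∷ s)) (sym (smaller-∷-< t z<c)) (jump z<c p) ,
  All-resp-↭ (↭-sym (pass-↭ p)) (z<c ∷ z<t) ∷ inc′
... | tri> _ _ c<z =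
  c ∷ z ∷ t , subst (λ k → Pass c (z ∷ t) k (c ∷ z ∷ t)) (sym (smaller≡0 c<zt)) (pass-emit c (z ∷ t)) ,
  c<zt ∷ z<t ∷ inc
  where
  c<zt : All (c <_) (z ∷ t)
  c<zt = c<z ∷ All.map (<-trans c<z) z<t

-- Insertion sort from the right: the row of a inserts a into the sorted rest.
code-path : ∀ {w} → Unique w → Path w (code w)
code-path {[]}    _         = [] , none , []
code-path {a ∷ w} (a≢w ∷ u)
  with t , r , inc ← code-path u
  with s , p , inc′ ← pass-insert (Unique-resp-↭ (prep a (↭-sym (rows-↭ r))) (a≢w ∷ u)) inc
  = s , subst (λ k → Rows (a ∷ w) (k ∷ code w) s) (∑-↭ _ (rows-↭ r)) (row r p) , inc′

-- The highest exponent: prefix sums bounded by larger predecessors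

-- The number of larger entries to the left of y, where y is a value and not a position.
L : List ℕ → ℕ → ℕ
L []      y = 0
L (x ∷ s) y with x ≟ y
... | yes _ = 0
... | no _  = when (y <ᵇ x) 1 + L s y

L-here : ∀ y s → L (y ∷ s) y ≡ 0
L-here y s with y ≟ y
... | yes _  = refl
... | no y≢y = ⊥-elim (y≢y refl)

L-there : ∀ {x y} s → x ≢ y → L (x ∷ s) y ≡ when (y <ᵇ x) 1 + L s y
L-there {x} {y} s x≢y with x ≟ y
... | yes x≡y = ⊥-elim (x≢y x≡y)
... | no _    = refl

-- An entry loses a larger predecessor only by being crossed. Once crossed it stays behind, and once
-- carried it only crosses smaller entries, so this happens at most once per pass.
pass-L : ∀ {c t k s y} → Pass c t k s → Unique (c ∷ t) → y ∈ c ∷ t →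
  L s y ≤ L (c ∷ t) y × L (c ∷ t) y ≤ suc (L s y)
pass-L end _ _ = ≤-refl , n≤1+n _
pass-L {c} (emit {s = s} p) _ (here refl) rewrite L-here c s = z≤n , ≤-trans (≤-reflexive (L-here c _)) z≤n
pass-L {c} {z ∷ t} {y = y} (emit {s = s} p) (c≢ ∷ u) (there y∈)
  rewrite L-there s (All.lookup c≢ y∈) | L-there (z ∷ t) (All.lookup c≢ y∈)
  with lo , hi ← pass-L p u y∈ =
  +-monoʳ-≤ (when (y <ᵇ c) 1) lo ,
  ≤-trans (+-monoʳ-≤ (when (y <ᵇ c) 1) hi) (≤-reflexive (+-suc _ (L s y)))
pass-L {c} {z ∷ t} (jump {s = s} z<c p) ((c≢z ∷ c≢t) ∷ (z≢t ∷ u)) (here refl)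
  rewrite L-here c (z ∷ t) | L-there s (≢-sym c≢z) | ≮⇒<ᵇ≡false (<⇒≯ z<c) =
  ≤-trans (proj₁ (pass-L p (c≢t ∷ u) (here refl))) (≤-reflexive (L-here c t)) , z≤n
pass-L {c} {z ∷ t} (jump {s = s} z<c p) ((c≢z ∷ c≢t) ∷ (z≢t ∷ u)) (there (here refl))
  rewrite L-here z s | L-there (z ∷ t) c≢z | L-here z t | <⇒<ᵇ≡true z<c = z≤n , ≤-refl
pass-L {c} {z ∷ t} {y = y} (jump {s = s} z<c p) ((c≢z ∷ c≢t) ∷ (z≢t ∷ u)) (there (there y∈))
  with lo , hi ← pass-L p (c≢t ∷ u) (there y∈)
  rewrite L-there s (All.lookup z≢t y∈) | L-there (z ∷ t) (All.lookup c≢t y∈)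
        | L-there t (All.lookup z≢t y∈) | L-there t (All.lookup c≢t y∈)
        | x∙yz≈y∙xz (when (y <ᵇ c) 1) (when (y <ᵇ z) 1) (L t y) =
  +-monoʳ-≤ (when (y <ᵇ z) 1) lo ,
  ≤-trans (+-monoʳ-≤ (when (y <ᵇ z) 1) hi) (≤-reflexive (+-suc _ (L s y)))

L-head-∸ : ∀ y s n → L (y ∷ s) y ∸ n ≡ 0
L-head-∸ y s n = trans (cong (_∸ n) (L-here y s)) (0∸n≡0 n)

L-∷-∸ : ∀ {c t s y} → c ≢ y → L (c ∷ t) y ∸ L (c ∷ s) y ≡ L t y ∸ L s y
L-∷-∸ {c} {t} {s} {y} c≢y = trans (cong₂ _∸_ (L-there t c≢y) (L-there s c≢y))
  ([m+n]∸[m+o]≡n∸o (when (y <ᵇ c) 1) (L t y) (L s y))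

L-swap : ∀ {c z t y} → c ≢ y → z ≢ y → L (c ∷ z ∷ t) y ≡ L (z ∷ c ∷ t) y
L-swap {c} {z} {t} {y} c≢y z≢y = begin
  L (c ∷ z ∷ t) y                               ≡⟨ L-there (z ∷ t) c≢y ⟩
  when (y <ᵇ c) 1 + L (z ∷ t) y                 ≡⟨ cong (λ m → when (y <ᵇ c) 1 + m) (L-there t z≢y) ⟩
  when (y <ᵇ c) 1 + (when (y <ᵇ z) 1 + L t y)   ≡⟨ x∙yz≈y∙xz (when (y <ᵇ c) 1) (when (y <ᵇ z) 1) (L t y) ⟩
  when (y <ᵇ z) 1 + (when (y <ᵇ c) 1 + L t y)   ≡⟨ cong (λ m → when (y <ᵇ z) 1 + m) (sym (L-there t c≢y)) ⟩
  when (y <ᵇ z) 1 + L (c ∷ t) y                 ≡⟨ sym (L-there (c ∷ t) z≢y) ⟩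
  L (z ∷ c ∷ t) y ∎
  where open ≡-Reasoning

L-second : ∀ {c z} t → z < c → L (c ∷ z ∷ t) z ≡ 1
L-second {c} {z} t z<c = trans (L-there (z ∷ t) (≢-sym (<⇒≢ z<c)))
  (cong₂ (λ b m → when b 1 + m) (<⇒<ᵇ≡true z<c) (L-here z t))

-- A crossing lowers `L` for the crossed entry alone; c is never crossed, so t accounts for all of
-- k.
pass-∑L : ∀ {c t k s} → Pass c t k s → Unique (c ∷ t) → k ≡ ∑ t (λ y → L (c ∷ t) y ∸ L s y)
pass-∑L end _ = refl
pass-∑L {c} {z ∷ t} {k} (emit {s = s} p) (c≢ ∷ u) = begin
  k                                         ≡⟨ pass-∑L p u ⟩
  ∑ t (λ y → L (z ∷ t) y ∸ L s y)
    ≡⟨ cong (_+ ∑ t (λ y → L (z ∷ t) y ∸ L s y)) (sym (L-head-∸ z t (L s z))) ⟩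
  ∑ (z ∷ t) (λ y → L (z ∷ t) y ∸ L s y)
    ≡⟨ ∑-cong-∈ (z ∷ t) (λ y∈ → sym (L-∷-∸ (All.lookup c≢ y∈))) ⟩
  ∑ (z ∷ t) (λ y → L (c ∷ z ∷ t) y ∸ L (c ∷ s) y) ∎
  where open ≡-Reasoning
pass-∑L {c} {z ∷ t} {suc k} (jump {s = s} z<c p) ((_ ∷ c≢t) ∷ (z≢t ∷ u)) = cong₂ _+_
  (sym (cong₂ _∸_ (L-second t z<c) (L-here z s)))
  (trans (pass-∑L p (c≢t ∷ u)) (∑-cong-∈ t (λ y∈ → sym (trans
    (cong (_∸ L (z ∷ s) _) (L-swap (All.lookup c≢t y∈) (All.lookup z≢t y∈)))
    (L-∷-∸ (All.lookup z≢t y∈))))))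

rows-L : ∀ {w e s y} → Rows w e s → Unique w → y ∈ w → L s y ≤ L w y
rows-L {a ∷ w} {y = y} (row {t = t} r p) (a≢w ∷ u) y∈ =
  ≤-trans (proj₁ (pass-L p (Unique-resp-↭ (prep a w↭t) (a≢w ∷ u)) (∈-resp-↭ (prep a w↭t) y∈))) (le y∈)
  where
  w↭t = ↭-sym (rows-↭ r)
  le : y ∈ a ∷ w → L (a ∷ t) y ≤ L (a ∷ w) y
  le (here refl) = ≤-reflexive (trans (L-here a t) (sym (L-here a w)))
  le (there y∈) rewrite L-there t (All.lookup a≢w y∈) | L-there w (All.lookup a≢w y∈) =
    +-monoʳ-≤ (when (y <ᵇ a) 1) (rows-L r u y∈)

-- Within one row an entry is passed at most once, so it contributes at most min(i, L w y - L s y)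
-- to the first i rows.
rows-top : ∀ i {w e s} → Rows w e s → Unique w → pre i e ≤ ∑ w (λ y → i ⊓ (L w y ∸ L s y))
rows-top zero    _    _ = z≤n
rows-top (suc i) none _ = z≤n
rows-top (suc i) {a ∷ w} {k ∷ e} {s} (row {t = t} r p) (a≢w ∷ u) = begin
  k + pre i e
    ≤⟨ +-mono-≤ (≤-reflexive (trans (pass-∑L p u′) (∑-↭ _ (rows-↭ r)))) (rows-top i r u) ⟩
  ∑ w (λ y → L (a ∷ t) y ∸ L s y) + ∑ w (λ y → i ⊓ (L w y ∸ L t y))
    ≡⟨ sym (∑-+ w _ _) ⟩
  ∑ w (λ y → (L (a ∷ t) y ∸ L s y) + i ⊓ (L w y ∸ L t y))
    ≤⟨ ∑-mono w bnd ⟩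
  ∑ w (λ y → suc i ⊓ (L (a ∷ w) y ∸ L s y))
    ≤⟨ m≤n+m _ _ ⟩
  ∑ (a ∷ w) (λ y → suc i ⊓ (L (a ∷ w) y ∸ L s y)) ∎
  where
  open ≤-Reasoning
  w↭t = ↭-sym (rows-↭ r)
  u′ = Unique-resp-↭ (prep a w↭t) (a≢w ∷ u)
  -- α tells whether a exceeds y. The row of a lowers `L` by at most 1, which gives the bound suc i;
  -- the drops in the two stages telescope, which gives the other bound.
  arith : ∀ α lt lw ls → ls ≤ α + lt → α + lt ≤ suc ls → lt ≤ lw →
          (α + lt ∸ ls) + i ⊓ (lw ∸ lt) ≤ suc i ⊓ (α + lw ∸ ls)
  arith α lt lw ls p q r = ⊓-glb
    (+-mono-≤ (≤-trans (∸-monoˡ-≤ ls q) (≤-reflexive (m+n∸n≡m 1 ls))) (m⊓n≤m i _))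
    (≤-trans (+-monoʳ-≤ (α + lt ∸ ls) (m⊓n≤n i _))
      (≤-reflexive (trans (sym (+-∸-comm (lw ∸ lt) p))
        (cong (_∸ ls) (trans (+-assoc α lt _) (cong (λ m → α + m) (m+[n∸m]≡n r)))))))
  bnd : ∀ {y} → y ∈ w → (L (a ∷ t) y ∸ L s y) + i ⊓ (L w y ∸ L t y) ≤ suc i ⊓ (L (a ∷ w) y ∸ L s y)
  bnd {y} y∈ with lo , hi ← pass-L p u′ (∈-resp-↭ (prep a w↭t) (there y∈))
    rewrite L-there t (All.lookup a≢w y∈) | L-there w (All.lookup a≢w y∈) =
    arith (when (y <ᵇ a) 1) (L t y) (L w y) (L s y) lo hi (rows-L r u y∈)

-- Summing min(i, l) over numbers l gives the first i parts of the conjugate partition.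
Λ : ℕ → List ℕ → ℕ
Λ i w = ∑ w (λ y → i ⊓ L w y)

path-top : ∀ {w e} → Unique w → Path w e → ∀ i → pre i e ≤ Λ i w
path-top {w} u (s , r , inc) i = ≤-trans (rows-top i r u)
  (∑-mono w (λ {y} y∈ → ⊓-monoʳ-≤ i (m∸n≤m (L w y) (L s y))))

∸-≤ᵇ : ∀ m n o → ((m ∸ n) ≤ᵇ o) ≡ (m ≤ᵇ n + o)
∸-≤ᵇ m       zero    o = refl
∸-≤ᵇ zero    (suc n) o = refl
∸-≤ᵇ (suc m) (suc n) o = trans (∸-≤ᵇ m n o) (sym (<ᵇ-suc m (n + o)))
  where
  <ᵇ-suc : ∀ m n → (m <ᵇ suc n) ≡ (m ≤ᵇ n)
  <ᵇ-suc zero    n = refl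
  <ᵇ-suc (suc m) n = refl

≤⇒≤ᵇ≡true : ∀ {m n} → m ≤ n → (m ≤ᵇ n) ≡ true
≤⇒≤ᵇ≡true {zero}  _   = refl
≤⇒≤ᵇ≡true {suc m} m≤n = <⇒<ᵇ≡true m≤n

≰⇒≤ᵇ≡false : ∀ {m n} → ¬ m ≤ n → (m ≤ᵇ n) ≡ false
≰⇒≤ᵇ≡false {zero}  m≰n = ⊥-elim (m≰n z≤n)
≰⇒≤ᵇ≡false {suc m} m≰n = ≮⇒<ᵇ≡false m≰n

Monotone : (ℕ → ℕ) → Set
Monotone η = ∀ {x y} → x < y → η x ≤ η y

when-≤ : ∀ {b b′} → (b ≡ true → b′ ≡ true) → when b 1 ≤ when b′ 1
when-≤ {true}  h rewrite h refl = ≤-refl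
when-≤ {false} h = z≤n

∸-monotone : ∀ {η} z → Monotone η → Monotone (λ y → η y ∸ when (y <ᵇ z) 1)
∸-monotone z mono {x} {y} x<y = ∸-mono (mono x<y)
  (when-≤ {y <ᵇ z} {x <ᵇ z} (λ y<z → <⇒<ᵇ≡true (<-trans x<y (<ᵇ≡true⇒< {y} {z} y<z))))

-- The pass in which exactly the entries y with L (c ∷ t) y ≥ η y are jumped over.
pass-greedy : ∀ c t η → Unique (c ∷ t) → Monotone η → 1 ≤ η c → (∀ {y} → y ∈ t → L (c ∷ t) y ≤ η y) →
  ∃ λ s → Pass c t (∑ t (λ y → when (η y ≤ᵇ L (c ∷ t) y) 1)) s ×
          (∀ {y} → y ∈ t → L (c ∷ t) y ≡ L s y + when (η y ≤ᵇ L (c ∷ t) y) 1)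
pass-greedy c []      η _ _ _ _ = c ∷ [] , end , λ ()
pass-greedy c (z ∷ t) η ((c≢z ∷ c≢t) ∷ (z≢t ∷ u)) mono ηc le with η z ≤? L (c ∷ z ∷ t) z
... | no ηz≰L = c ∷ s , subst (λ k → Pass c (z ∷ t) k (c ∷ s)) (sym count) (emit p) , eqs
  where
  L≡ : L (c ∷ z ∷ t) z ≡ when (z <ᵇ c) 1
  L≡ = trans (L-there (z ∷ t) c≢z) (trans (cong (λ m → _ + m) (L-here z t)) (+-identityʳ _))
  -- The emitted c stays in front for good, so `L` within the rest and the threshold drop together
  -- for each y < c.
  η′ : ℕ → ℕ
  η′ y = η y ∸ when (y <ᵇ c) 1
  IH = pass-greedy z t η′ (z≢t ∷ u) (∸-monotone c mono)
    (m<n⇒0<n∸m (subst (_< η z) L≡ (≰⇒> ηz≰L)))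
    (λ {y} y∈ → m+n≤o⇒m≤o∸n (L (z ∷ t) y) (subst (_≤ η y)
       (trans (L-there (z ∷ t) (All.lookup c≢t y∈)) (+-comm _ (L (z ∷ t) y))) (le (there y∈))))
  s = proj₁ IH
  p = proj₁ (proj₂ IH)
  flag : ∀ {y} → y ∈ t → (η y ≤ᵇ L (c ∷ z ∷ t) y) ≡ (η′ y ≤ᵇ L (z ∷ t) y)
  flag {y} y∈ = trans (cong (η y ≤ᵇ_) (L-there (z ∷ t) (All.lookup c≢t y∈)))
    (sym (∸-≤ᵇ (η y) (when (y <ᵇ c) 1) (L (z ∷ t) y)))
  count : ∑ (z ∷ t) (λ y → when (η y ≤ᵇ L (c ∷ z ∷ t) y) 1) ≡ ∑ t (λ y → when (η′ y ≤ᵇ L (z ∷ t) y) 1)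
  count = cong₂ _+_ (cong (λ b → when b 1) (≰⇒≤ᵇ≡false ηz≰L))
    (∑-cong-∈ t (λ y∈ → cong (λ b → when b 1) (flag y∈)))
  eqs : ∀ {y} → y ∈ z ∷ t → L (c ∷ z ∷ t) y ≡ L (c ∷ s) y + when (η y ≤ᵇ L (c ∷ z ∷ t) y) 1
  eqs (here refl) rewrite ≰⇒≤ᵇ≡false ηz≰L = trans L≡ (sym (trans (+-identityʳ _) (trans (L-there s c≢z)
    (trans (cong (λ m → _ + m) (n≤0⇒n≡0 (≤-trans (proj₁ (pass-L p (z≢t ∷ u) (here refl)))
      (≤-reflexive (L-here z t))))) (+-identityʳ _)))))
  eqs {y} (there y∈) rewrite flag y∈ = trans (L-there (z ∷ t) (All.lookup c≢t y∈))
    (trans (cong (λ m → when (y <ᵇ c) 1 + m) (proj₂ (proj₂ IH) y∈))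
      (trans (sym (+-assoc (when (y <ᵇ c) 1) (L s y) _))
        (cong (_+ when (η′ y ≤ᵇ L (z ∷ t) y) 1) (sym (L-there s (All.lookup c≢t y∈))))))
... | yes ηz≤L = z ∷ s , subst (λ k → Pass c (z ∷ t) k (z ∷ s)) (sym count) (jump z<c p) , eqs
  where
  -- If z exceeded c, its `L` would be 0, while its threshold is at least η c ≥ 1 by monotonicity.
  z<c : z < c
  z<c with <-cmp z c
  ... | tri< z<c _ _ = z<c
  ... | tri≈ _ z≡c _ = ⊥-elim (c≢z (sym z≡c))
  ... | tri> z≮c _ c<z = ⊥-elim (<⇒≱ (≤-trans ηc (mono c<z)) (≤-trans ηz≤L (≤-reflexive
    (trans (L-there (z ∷ t) c≢z) (cong₂ (λ b m → when b 1 + m) (≮⇒<ᵇ≡false z≮c) (L-here z t))))))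
  η′ : ℕ → ℕ
  η′ y = η y ∸ when (y <ᵇ z) 1
  L-c∷ : ∀ {y} → y ∈ t → L (c ∷ z ∷ t) y ≡ when (y <ᵇ z) 1 + L (c ∷ t) y
  L-c∷ y∈ = trans (L-swap (All.lookup c≢t y∈) (All.lookup z≢t y∈)) (L-there (c ∷ t) (All.lookup z≢t y∈))
  IH = pass-greedy c t η′ (c≢t ∷ u) (∸-monotone z mono)
    (subst (1 ≤_) (cong (λ b → η c ∸ when b 1) (sym (≮⇒<ᵇ≡false (<⇒≯ z<c)))) ηc)
    (λ {y} y∈ → m+n≤o⇒m≤o∸n (L (c ∷ t) y)
      (subst (_≤ η y) (trans (L-c∷ y∈) (+-comm _ (L (c ∷ t) y))) (le (there y∈))))
  s = proj₁ IH
  p = proj₁ (proj₂ IH)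
  flag : ∀ {y} → y ∈ t → (η y ≤ᵇ L (c ∷ z ∷ t) y) ≡ (η′ y ≤ᵇ L (c ∷ t) y)
  flag {y} y∈ = trans (cong (η y ≤ᵇ_) (L-c∷ y∈)) (sym (∸-≤ᵇ (η y) (when (y <ᵇ z) 1) (L (c ∷ t) y)))
  count : ∑ (z ∷ t) (λ y → when (η y ≤ᵇ L (c ∷ z ∷ t) y) 1) ≡ suc (∑ t (λ y → when (η′ y ≤ᵇ L (c ∷ t) y) 1))
  count = cong₂ _+_ (cong (λ b → when b 1) (≤⇒≤ᵇ≡true ηz≤L))
    (∑-cong-∈ t (λ y∈ → cong (λ b → when b 1) (flag y∈)))
  eqs : ∀ {y} → y ∈ z ∷ t → L (c ∷ z ∷ t) y ≡ L (z ∷ s) y + when (η y ≤ᵇ L (c ∷ z ∷ t) y) 1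
  eqs (here refl) = trans (L-second t z<c)
    (sym (cong₂ (λ m b → m + when b 1) (L-here z s) (≤⇒≤ᵇ≡true ηz≤L)))
  eqs {y} (there y∈) rewrite flag y∈ = trans (L-c∷ y∈)
    (trans (cong (λ m → when (y <ᵇ z) 1 + m) (proj₂ (proj₂ IH) y∈))
      (trans (sym (+-assoc (when (y <ᵇ z) 1) (L s y) _))
        (cong (_+ when (η′ y ≤ᵇ L (c ∷ t) y) 1) (sym (L-there s (All.lookup z≢t y∈))))))

-- θ y is the number of entries of an omitted prefix that are smaller than y: the prefix rows can
-- pass y over at most that many further positions.
rows-greedy : ∀ w θ → Unique w → Monotone θ →
  ∃ λ e → ∃ λ s → Rows w e s × (∀ {y} → y ∈ w → L s y ≡ L w y ⊓ θ y) ×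
                  (∀ i → pre i e ≡ ∑ w (λ y → i ⊓ (L w y ∸ θ y)))
rows-greedy []      θ _ _ = [] , [] , none , (λ ()) , λ { zero → refl ; (suc i) → refl }
rows-greedy (a ∷ w) θ (a≢w ∷ u) mono
  with e , t , r , Lt , pre-e ← rows-greedy w (λ y → θ y + when (a <ᵇ y) 1) u
    (λ {x} {y} x<y → +-mono-≤ (mono x<y)
      (when-≤ {a <ᵇ x} {a <ᵇ y} (λ a<x → <⇒<ᵇ≡true (<-trans (<ᵇ≡true⇒< {a} {x} a<x) x<y))))
  = _ , proj₁ G , row r (proj₁ (proj₂ G)) , Ls , pre-ke
  where
  η : ℕ → ℕ
  η y = suc (θ y)
  w↭t = ↭-sym (rows-↭ r)
  u′ = Unique-resp-↭ (prep a w↭t) (a≢w ∷ u)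
  -- Either a counts towards `L` of y or towards the θ used for w; so the threshold in the row of a
  -- is suc (θ y) in both cases.
  split : ∀ {y} → a ≢ y → when (y <ᵇ a) 1 + (θ y + when (a <ᵇ y) 1) ≡ η y
  split {y} a≢y with <-cmp a y
  ... | tri< a<y _ y≮a rewrite <⇒<ᵇ≡true a<y | ≮⇒<ᵇ≡false y≮a = +-comm (θ y) 1
  ... | tri≈ _ a≡y _ = ⊥-elim (a≢y a≡y)
  ... | tri> a≮y _ y<a rewrite <⇒<ᵇ≡true y<a | ≮⇒<ᵇ≡false a≮y = cong suc (+-identityʳ (θ y))
  L-at : ∀ {y} → y ∈ w → L (a ∷ t) y ≡ L (a ∷ w) y ⊓ η y
  L-at {y} y∈ = begin
    L (a ∷ t) y                                     ≡⟨ L-there t a≢y ⟩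
    α + L t y                                       ≡⟨ cong (λ m → α + m) (Lt y∈) ⟩
    α + L w y ⊓ (θ y + when (a <ᵇ y) 1)             ≡⟨ +-distribˡ-⊓ α (L w y) _ ⟩
    (α + L w y) ⊓ (α + (θ y + when (a <ᵇ y) 1))     ≡⟨ cong₂ _⊓_ (sym (L-there w a≢y)) (split a≢y) ⟩
    L (a ∷ w) y ⊓ η y ∎
    where
    open ≡-Reasoning
    α = when (y <ᵇ a) 1
    a≢y = All.lookup a≢w y∈
  G = pass-greedy a t η u′ (λ x<y → s≤s (mono x<y)) (s≤s z≤n)
    (λ {y} y∈ → ≤-trans (≤-reflexive (L-at (∈-resp-↭ (rows-↭ r) y∈))) (m⊓n≤n (L (a ∷ w) y) (η y)))
  arith₁ : ∀ X θ l → X ⊓ suc θ ≡ l + when (suc θ ≤ᵇ (X ⊓ suc θ)) 1 → l ≡ X ⊓ θ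
  arith₁ X θ l eq with suc θ ≤? X
  ... | yes θ<X rewrite m≥n⇒m⊓n≡n θ<X | ≤⇒≤ᵇ≡true (≤-refl {suc θ}) | m≥n⇒m⊓n≡n (<⇒≤ θ<X) =
    sym (suc-injective (trans eq (+-comm l 1)))
  ... | no θ≮X rewrite m≤n⇒m⊓n≡m (m≤n⇒m≤1+n (≮⇒≥ θ≮X)) | ≰⇒≤ᵇ≡false θ≮X | m≤n⇒m⊓n≡m (≮⇒≥ θ≮X) =
    sym (trans eq (+-identityʳ l))
  arith₂ : ∀ X θ i → when (suc θ ≤ᵇ (X ⊓ suc θ)) 1 + i ⊓ (X ∸ suc θ) ≡ suc i ⊓ (X ∸ θ)
  arith₂ X θ i with suc θ ≤? X
  ... | yes θ<X rewrite m≥n⇒m⊓n≡n θ<X | ≤⇒≤ᵇ≡true (≤-refl {suc θ}) =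
    cong (suc i ⊓_) (trans (sym (+-∸-assoc 1 θ<X)) refl)
  ... | no θ≮X rewrite m≤n⇒m⊓n≡m (m≤n⇒m≤1+n (≮⇒≥ θ≮X)) | ≰⇒≤ᵇ≡false θ≮X
      | m≤n⇒m∸n≡0 (≮⇒≥ θ≮X) | m≤n⇒m∸n≡0 (m≤n⇒m≤1+n (≮⇒≥ θ≮X)) = ⊓-zeroʳ i
  Ls : ∀ {y} → y ∈ a ∷ w → L (proj₁ G) y ≡ L (a ∷ w) y ⊓ θ y
  Ls (here refl) = trans (n≤0⇒n≡0 (≤-trans (proj₁ (pass-L (proj₁ (proj₂ G)) u′ (here refl)))
    (≤-reflexive (L-here a t)))) (cong (_⊓ θ a) (sym (L-here a w)))
  Ls {y} (there y∈) = arith₁ (L (a ∷ w) y) (θ y) (L (proj₁ G) y)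
    (subst (λ m → m ≡ L (proj₁ G) y + when (η y ≤ᵇ m) 1) (L-at y∈)
      (proj₂ (proj₂ G) (∈-resp-↭ w↭t y∈)))
  pre-ke : ∀ i → pre i (_ ∷ e) ≡ ∑ (a ∷ w) (λ y → i ⊓ (L (a ∷ w) y ∸ θ y))
  pre-ke zero    = sym (∑-zero (a ∷ w) (λ _ → refl))
  pre-ke (suc i) = begin
    ∑ t (λ y → when (η y ≤ᵇ L (a ∷ t) y) 1) + pre i e
      ≡⟨ cong₂ _+_ (∑-↭ _ (rows-↭ r)) (pre-e i) ⟩
    ∑ w (λ y → when (η y ≤ᵇ L (a ∷ t) y) 1) + ∑ w (λ y → i ⊓ (L w y ∸ (θ y + when (a <ᵇ y) 1)))
      ≡⟨ sym (∑-+ w _ _) ⟩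
    ∑ w (λ y → when (η y ≤ᵇ L (a ∷ t) y) 1 + i ⊓ (L w y ∸ (θ y + when (a <ᵇ y) 1)))
      ≡⟨ ∑-cong-∈ w (λ {y} y∈ → trans
           (cong₂ (λ m n → when (η y ≤ᵇ m) 1 + i ⊓ n) (L-at y∈)
             (trans (sym ([m+n]∸[m+o]≡n∸o (when (y <ᵇ a) 1) (L w y) _))
               (cong₂ _∸_ (sym (L-there w (All.lookup a≢w y∈))) (split (All.lookup a≢w y∈)))))
           (arith₂ (L (a ∷ w) y) (θ y) i)) ⟩
    ∑ w (λ y → suc i ⊓ (L (a ∷ w) y ∸ θ y))
      ≡⟨ cong (_+ ∑ w (λ y → suc i ⊓ (L (a ∷ w) y ∸ θ y)))
           (sym (trans (cong (suc i ⊓_) (L-head-∸ a w (θ a))) refl)) ⟩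
    ∑ (a ∷ w) (λ y → suc i ⊓ (L (a ∷ w) y ∸ θ y)) ∎
    where open ≡-Reasoning

L≡0⇒increasing : ∀ {s} → Unique s → (∀ {y} → y ∈ s → L s y ≡ 0) → AllPairs _<_ s
L≡0⇒increasing []             _ = []
L≡0⇒increasing {x ∷ s} (x≢s ∷ u) h =
  All.tabulate (λ {y} y∈ → ≰⇒> (λ y≤x → 1+n≢0 (trans
    (sym (cong (λ b → when b 1 + L s y) (<⇒<ᵇ≡true (≤∧≢⇒< y≤x (≢-sym (All.lookup x≢s y∈))))))
    (eq y∈)))) ∷
  L≡0⇒increasing u (λ {y} y∈ → m+n≡0⇒n≡0 (when (y <ᵇ x) 1) (eq y∈))
  where
  eq : ∀ {y} → y ∈ s → when (y <ᵇ x) 1 + L s y ≡ 0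
  eq y∈ = trans (sym (L-there s (All.lookup x≢s y∈))) (h (there y∈))

-- No prefix is omitted, so θ = 0: every larger predecessor gets removed and the outcome is sorted.
top-path : ∀ {w} → Unique w → ∃ λ e → Path w e × ∀ i → pre i e ≡ Λ i w
top-path {w} u with e , s , r , Ls , pre-e ← rows-greedy w (λ _ → 0) u (λ _ → z≤n) =
  e , (s , r , L≡0⇒increasing (Unique-resp-↭ (↭-sym (rows-↭ r)) u)
    (λ {y} y∈ → trans (Ls (∈-resp-↭ (rows-↭ r) y∈)) (⊓-zeroʳ (L w y)))) , pre-e

-- Paths as the support of F w

∑≢0⇒ : ∀ {A : Set} (xs : List A) {f : A → ℕ} → ∑ xs f ≢ 0 → ∃ λ x → x ∈ xs × f x ≢ 0
∑≢0⇒ []       ne = ⊥-elim (ne refl)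
∑≢0⇒ (x ∷ xs) {f} ne with f x ≟ 0
... | no fx≢0 = x , here refl , fx≢0
... | yes fx≡0 with y , y∈ , fy≢0 ← ∑≢0⇒ xs (λ eq → ne (cong₂ _+_ fx≡0 eq)) = y , there y∈ , fy≢0

-- The coefficient is a sum of natural numbers, so the contribution of one path cannot cancel.
path⇒coeff≢0 : ∀ {w e α} → Path w e → map +_ e ~ α → coeff (F w) α ≢ + 0
path⇒coeff≢0 {w} {e} {α} (s , r , inc) e~α eq = 1+n≢0 (trans (sym weight≡1)
  (∑≡0⇒ {xs = rows w} (ℤₚ.+-injective (trans (sym (coeff-F w α)) eq)) (Rows⇒∈rows r)))
  where
  weight≡1 : weight α (e , s) ≡ 1
  weight≡1 = cong₂ (λ b b′ → when b (when b′ 1)) (sorted⁺ inc) (sameExp⁺ (map +_ e) α (expAt≡ e~α))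

coeff≢0⇒path : ∀ {w α} → coeff (F w) α ≢ + 0 → ∃ λ e → Path w e × map +_ e ~ α
coeff≢0⇒path {w} {α} ne
  with (e , s) , es∈ , ne′ ← ∑≢0⇒ (rows w) (λ eq → ne (trans (coeff-F w α) (cong +_ eq)))
  with sorted s in eq | sameExp (map +_ e) α in eq′
... | true  | true  = e , (s , ∈rows⇒Rows w es∈ , sorted⁻ s eq) , pointwise (sameExp⁻ (map +_ e) α eq′)
... | true  | false = ⊥-elim (ne′ refl)
... | false | _     = ⊥-elim (ne′ refl)

-- Words whose polynomials are exchanged by f ↦ x^δ f(x⁻¹)

Dual : ℕ → List ℕ → List ℕ → Set
Dual n w u = ∀ α → coeff (F u) α ≡ coeff (F w) (complementExp n α)

dual-sym : ∀ {n w u} → Dual n w u → Dual n u w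
dual-sym {n} {w} d α = trans (coeff-~ (F w) (~-sym (complement-involutive n α))) (sym (d (complementExp n α)))

expAt-map : ∀ e j → expAt (map +_ e) j ≡ + at e j
expAt-map []      j       = refl
expAt-map (k ∷ e) zero    = refl
expAt-map (k ∷ e) (suc j) = expAt-map e j

dual-path : ∀ {n w u e} → Dual n w u → Path w e →
  ∃ λ e′ → Path u e′ × (∀ {j} → j < n → at e j + at e′ j ≡ n ∸ suc j)
dual-path {n} {w} {u} {e} d p with coeff≢0⇒path {u} {complementExp n (map +_ e)} (λ eq →
    path⇒coeff≢0 p (~-sym (complement-involutive n (map +_ e))) (trans (sym (d _)) eq))
... | e′ , p′ , e′~ = e′ , p′ , λ {j} j<n → ℤₚ.+-injective (begin
  + (at e j + at e′ j)                                 ≡⟨ ℤₚ.pos-+ (at e j) (at e′ j) ⟩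
  + at e j ℤ.+ + at e′ j
    ≡⟨ cong (λ z → + at e j ℤ.+ z) (trans (sym (expAt-map e′ j)) (trans (expAt≡ e′~ j) (expAt-complement-< _ j<n))) ⟩
  + at e j ℤ.+ (+ (n ∸ suc j) ℤ.- expAt (map +_ e) j)  ≡⟨ cong (λ z → + at e j ℤ.+ (+ (n ∸ suc j) ℤ.- z)) (expAt-map e j) ⟩
  + at e j ℤ.+ (+ (n ∸ suc j) ℤ.- + at e j)
    ≡⟨ solveℤ 2 (λ a m → a ⊞ (m ⊟ a) ⊜ m) refl (+ at e j) (+ (n ∸ suc j)) ⟩
  + (n ∸ suc j) ∎)
  where open ≡-Reasoning

-- Comparing the extreme exponents of a dual pair

Δ : ℕ → ℕ → ℕ
Δ n zero    = 0
Δ n (suc j) = Δ n j + (n ∸ suc j)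

pre-dual : ∀ {n e e′} → (∀ {j} → j < n → at e j + at e′ j ≡ n ∸ suc j) →
  ∀ j → j ≤ n → pre j e + pre j e′ ≡ Δ n j
pre-dual         h zero    _   = refl
pre-dual {n} {e} {e′} h (suc j) j<n = begin
  pre (suc j) e + pre (suc j) e′             ≡⟨ cong₂ _+_ (pre-suc j e) (pre-suc j e′) ⟩
  (pre j e + at e j) + (pre j e′ + at e′ j)
    ≡⟨ solve 4 (λ a b c d → (a :+ b) :+ (c :+ d) := (a :+ c) :+ (b :+ d)) refl (pre j e) _ _ _ ⟩
  (pre j e + pre j e′) + (at e j + at e′ j)  ≡⟨ cong₂ _+_ (pre-dual {e = e} {e′} h j (<⇒≤ j<n)) (h j<n) ⟩
  Δ n j + (n ∸ suc j) ∎
  where open ≡-Reasoning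

-- The complement of the top path of w is a path of u and lies above the code of u; the complement
-- of the code path of u is a path of w and lies below Λ.
Λ-code : ∀ {n w u} → Unique w → Unique u → Dual n w u → ∀ j → j ≤ n → Λ j w + pre j (code u) ≡ Δ n j
Λ-code {n} {w} {u} uw uu d j j≤n
  with e , p , pre-e ← top-path uw
  with e₁ , p₁ , h₁ ← dual-path d p
  with e₂ , p₂ , h₂ ← dual-path (dual-sym {n} {w} {u} d) (code-path uu)
  = ≤-antisym
    (begin
      Λ j w + pre j (code u)     ≤⟨ +-mono-≤ (≤-reflexive (sym (pre-e j))) (path-bottom p₁ j) ⟩
      pre j e + pre j e₁         ≡⟨ pre-dual {e = e} {e₁} h₁ j j≤n ⟩
      Δ n j ∎)
    (begin
      Δ n j                      ≡⟨ sym (pre-dual {e = code u} {e₂} h₂ j j≤n) ⟩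
      pre j (code u) + pre j e₂  ≤⟨ +-monoʳ-≤ (pre j (code u)) (path-top uw p₂ j) ⟩
      pre j (code u) + Λ j w     ≡⟨ +-comm (pre j (code u)) (Λ j w) ⟩
      Λ j w + pre j (code u) ∎)
  where open ≤-Reasoning

-- Three consecutive instances of `Λ-code`; the `suc` is the second difference of the prefix sums of
-- δ_n, and terms are moved across to avoid subtraction.
Λ-second-difference : ∀ {n w u q} → Unique w → Unique u → Dual n w u → suc q < n →
  (Λ q w + Λ (2+ q) w) + suc (at (code u) (suc q)) ≡ (Λ (suc q) w + Λ (suc q) w) + at (code u) q
Λ-second-difference {n} {w} {u} {q} uw uu d q<n = combine {Λ q w} {Λ (suc q) w} {Λ (2+ q) w} {pre q (code u)} {at (code u) q}
  (Λ-code uw uu d q (<⇒≤ (<-trans (n<1+n q) q<n)))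
  (subst₂ (λ a b → Λ (suc q) w + a ≡ Δ n q + b) (pre-suc q (code u)) (sym (∸-suc q<n))
    (Λ-code uw uu d (suc q) (<⇒≤ q<n)))
  (subst₂ (λ a b → Λ (2+ q) w + a ≡ Δ n q + b + (n ∸ (2+ q)))
    (trans (pre-suc (suc q) (code u)) (cong (_+ at (code u) (suc q)) (pre-suc q (code u)))) (sym (∸-suc q<n))
    (Λ-code uw uu d (2+ q) q<n))
  where
  ∸-suc : ∀ {m n} → m < n → suc (n ∸ suc m) ≡ n ∸ m
  ∸-suc {m} m<n = sym (+-∸-assoc 1 m<n)
  combine : ∀ {l₀ l₁ l₂ c c₀ c₁ D d} → l₀ + c ≡ D → l₁ + (c + c₀) ≡ D + suc d →
            l₂ + (c + c₀ + c₁) ≡ D + suc d + d → (l₀ + l₂) + suc c₁ ≡ (l₁ + l₁) + c₀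
  combine {l₀} {l₁} {l₂} {c} {c₀} {c₁} {D} {d} e₀ e₁ e₂ = +-cancelʳ-≡ (c + c + c₀) _ _ (begin
    (l₀ + l₂) + suc c₁ + (c + c + c₀)
      ≡⟨ solve 5 (λ a b c c₀ c₁ → (a :+ b) :+ (con 1 :+ c₁) :+ (c :+ c :+ c₀)
           := (a :+ c) :+ (b :+ (c :+ c₀ :+ c₁)) :+ con 1) refl l₀ l₂ c c₀ c₁ ⟩
    (l₀ + c) + (l₂ + (c + c₀ + c₁)) + 1
      ≡⟨ cong₂ (λ a b → a + b + 1) e₀ e₂ ⟩
    D + (D + suc d + d) + 1
      ≡⟨ solve 2 (λ D d → D :+ (D :+ (con 1 :+ d) :+ d) :+ con 1 := (D :+ (con 1 :+ d)) :+ (D :+ (con 1 :+ d))) refl D d ⟩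
    (D + suc d) + (D + suc d)
      ≡⟨ sym (cong₂ _+_ e₁ e₁) ⟩
    (l₁ + (c + c₀)) + (l₁ + (c + c₀))
      ≡⟨ solve 3 (λ l c c₀ → (l :+ (c :+ c₀)) :+ (l :+ (c :+ c₀)) := (l :+ l) :+ c₀ :+ (c :+ c :+ c₀)) refl l₁ c c₀ ⟩
    (l₁ + l₁) + c₀ + (c + c + c₀) ∎)
    where open ≡-Reasoning

⊓-concave : ∀ q x → q ⊓ x + 2+ q ⊓ x ≤ suc q ⊓ x + suc q ⊓ x
⊓-concave zero    zero          = z≤n
⊓-concave zero    (suc zero)    = s≤s z≤n
⊓-concave zero    (suc (suc x)) = ≤-refl
⊓-concave (suc q) zero          = z≤n
⊓-concave (suc q) (suc x)       = s≤s (subst₂ _≤_ (sym (+-suc _ _)) (sym (+-suc _ _)) (s≤s (⊓-concave q x)))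

⊓-strictly-concave : ∀ q → q ⊓ suc q + 2+ q ⊓ suc q < suc q ⊓ suc q + suc q ⊓ suc q
⊓-strictly-concave q rewrite m≤n⇒m⊓n≡m (n≤1+n q) | m≥n⇒m⊓n≡n (n≤1+n (suc q)) | ⊓-idem q = ≤-refl

code-drop : ∀ {n w u q} → Unique w → Unique u → Dual n w u → suc q < n →
  at (code u) q ≤ suc (at (code u) (suc q))
code-drop {n} {w} {u} {q} uw uu d q<n = +-cancelˡ-≤ (Λ q w + Λ (2+ q) w) _ _ (≤-trans
  (+-monoˡ-≤ (at (code u) q) (subst₂ _≤_ (∑-+ w _ _) (∑-+ w _ _) (∑-mono w (λ {y} _ → ⊓-concave q (L w y)))))
  (≤-reflexive (sym (Λ-second-difference {n} {w} {u} uw uu d q<n))))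

-- At y the function min(·, `L w y`) bends strictly at q + 1, which uses up the drop of 1 that δ_n
-- allows.
code-no-drop : ∀ {n w u q y} → Unique w → Unique u → Dual n w u → suc q < n → y ∈ w → L w y ≡ suc q →
  at (code u) q ≤ at (code u) (suc q)
code-no-drop {n} {w} {u} {q} {y} uw uu d q<n y∈ Ly = s≤s⁻¹ (+-cancelˡ-≤ (Λ q w + Λ (2+ q) w) _ _ (≤-trans
  (≤-reflexive (+-suc _ _)) (≤-trans
  (+-monoˡ-≤ (at (code u) q) (subst₂ _<_ (∑-+ w _ _) (∑-+ w _ _)
    (∑-mono-< {xs = w} (λ {y} _ → ⊓-concave q (L w y)) y∈
      (subst (λ x → q ⊓ x + 2+ q ⊓ x < suc q ⊓ x + suc q ⊓ x) (sym Ly) (⊓-strictly-concave q)))))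
  (≤-reflexive (sym (Λ-second-difference {n} {w} {u} uw uu d q<n))))))

-- What is smaller than d is smaller than c, and c counts d besides.
code-descent : ∀ {q w} → Descent q w → at (code w) (suc q) < at (code w) q
code-descent {w = c ∷ d ∷ w} (here d<c) rewrite smaller-∷-< w d<c =
  s≤s (∑-mono w (λ {z} _ → when-≤ {z <ᵇ d} {z <ᵇ c} (λ z<d → <⇒<ᵇ≡true (<-trans (<ᵇ≡true⇒< {z} {d} z<d) d<c))))
code-descent (there p) = code-descent p

-- Left-to-right minima

-- The index is that of the descent: the left-to-right minimum sits at position suc i, and its `L`
-- is then suc i.
MinimumAfter : ℕ → List ℕ → Set
MinimumAfter i w = ∀ {j} → j ≤ i → at w (suc i) < at w j

at-∈ : ∀ {p} w → p < length w → at w p ∈ w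
at-∈ {zero}  (a ∷ w) _       = here refl
at-∈ {suc p} (a ∷ w) (s≤s l) = there (at-∈ w l)

L-at-≤ : ∀ {p} w → Unique w → p < length w → L w (at w p) ≤ p
L-at-≤ {zero}  (a ∷ w) _          _       = ≤-reflexive (L-here a w)
L-at-≤ {suc p} (a ∷ w) (a≢w ∷ u) (s≤s l)
  rewrite L-there w (All.lookup a≢w (at-∈ w l)) = +-mono-≤ (when-≤1 (at w p <ᵇ a)) (L-at-≤ w u l)
  where
  when-≤1 : ∀ b → when b 1 ≤ 1
  when-≤1 true  = ≤-refl
  when-≤1 false = z≤n

minimum⇒L : ∀ {p} w → Unique w → p < length w → (∀ {j} → j < p → at w p < at w j) → L w (at w p) ≡ p
minimum⇒L {zero}  (a ∷ w) _         _       h = L-here a w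
minimum⇒L {suc p} (a ∷ w) (a≢w ∷ u) (s≤s l) h
  rewrite L-there w (All.lookup a≢w (at-∈ w l)) | <⇒<ᵇ≡true (h {0} (s≤s z≤n)) =
  cong suc (minimum⇒L w u l (λ j<p → h (s≤s j<p)))

L⇒minimum : ∀ {p} w → Unique w → p < length w → p ≤ L w (at w p) → ∀ {j} → j < p → at w p < at w j
L⇒minimum {suc p} (a ∷ w) (a≢w ∷ u) (s≤s l) h {j} j<p
  rewrite L-there w (All.lookup a≢w (at-∈ w l)) with at w p <? a
... | no ≮a rewrite ≮⇒<ᵇ≡false ≮a = ⊥-elim (<⇒≱ h (L-at-≤ w u l))
... | yes <a rewrite <⇒<ᵇ≡true <a with j
...   | zero  = <a
...   | suc j = L⇒minimum w u l (s≤s⁻¹ h) (s≤s⁻¹ j<p)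

L-swapAt-≤ : ∀ {i u} → Unique u → Descent i u → ∀ {y} → y ∈ u → L (swapAt i u) y ≤ L u y
L-swapAt-≤ {u = c ∷ d ∷ w} ((c≢d ∷ c≢w) ∷ (d≢w ∷ _)) (here d<c) (here refl)
  rewrite L-there (c ∷ w) (≢-sym c≢d) | L-here c w | ≮⇒<ᵇ≡false (<⇒≯ d<c) = z≤n
L-swapAt-≤ {u = c ∷ d ∷ w} _ (here d<c) (there (here refl)) rewrite L-here d (c ∷ w) = z≤n
L-swapAt-≤ {u = c ∷ d ∷ w} ((_ ∷ c≢w) ∷ (d≢w ∷ _)) (here d<c) (there (there y∈)) =
  ≤-reflexive (L-swap (All.lookup d≢w y∈) (All.lookup c≢w y∈))
L-swapAt-≤ {suc i} {a ∷ w} _ (there p) (here refl) rewrite L-here a (swapAt i w) = z≤n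
L-swapAt-≤ {suc i} {a ∷ w} (a≢w ∷ u) (there p) {y} (there y∈)
  rewrite L-there w (All.lookup a≢w y∈) | L-there (swapAt i w) (All.lookup a≢w y∈) =
  +-monoʳ-≤ (when (y <ᵇ a) 1) (L-swapAt-≤ u p y∈)

L-swapAt-at : ∀ {i u} → Unique u → Descent i u →
  L u (at u (suc i)) ≡ suc (L (swapAt i u) (at u (suc i)))
L-swapAt-at {u = c ∷ d ∷ w} _ (here d<c) = trans (L-second w d<c) (cong suc (sym (L-here d (c ∷ w))))
L-swapAt-at {suc i} {a ∷ w} (a≢w ∷ u) (there p) = trans (L-there w a≢)
  (trans (cong (λ m → when (at w (suc i) <ᵇ a) 1 + m) (L-swapAt-at u p))
    (trans (+-suc _ _) (cong suc (sym (L-there (swapAt i w) a≢)))))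
  where a≢ = All.lookup a≢w (at-∈ w (proj₁ (adjacent⁻ p)))

-- The exchange lowers `L` by 1 at u_{i+1} and raises it nowhere; capping at q, the old value of `L`
-- there, keeps this loss visible.
Λ-swapAt : ∀ {i u} → Unique u → Descent i u → let q = L u (at u (suc i)) in Λ q (swapAt i u) < Λ q u
Λ-swapAt {i} {u} uu p = subst (_< Λ q u) (∑-↭ (λ y → q ⊓ L (swapAt i u) y) (↭-sym (swapAt-↭ i u)))
  (∑-mono-< {xs = u} (λ y∈ → ⊓-monoʳ-≤ q (L-swapAt-≤ uu p y∈)) (at-∈ u (proj₁ (adjacent⁻ p)))
    (subst₂ (λ a b → a < q ⊓ b) (sym (m≥n⇒m⊓n≡n (<⇒≤ lt))) refl (subst (L (swapAt i u) y <_) (sym (⊓-idem q)) lt)))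
  where
  y = at u (suc i)
  q = L u y
  lt : L (swapAt i u) y < q
  lt = ≤-reflexive (sym (L-swapAt-at uu p))

pre-cong : ∀ q {e e′} → (∀ {j} → j < q → at e j ≡ at e′ j) → pre q e ≡ pre q e′
pre-cong zero    h = refl
pre-cong (suc q) {e} {e′} h = trans (pre-suc q e)
  (trans (cong₂ _+_ (pre-cong q (λ j<q → h (m<n⇒m<1+n j<q))) (h ≤-refl)) (sym (pre-suc q e′)))

adjacent? : ∀ {R : ℕ → ℕ → Set} → (∀ a b → Dec (R a b)) → ∀ i w → Dec (Adjacent R i w)
adjacent? R? i w = map′ (λ (l , r) → adjacent i w l r) adjacent⁻
  (suc i <? length w ×-dec R? (at w i) (at w (suc i)))

-- The last row has nothing to its right to cross, and past it `at` returns its default 0.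
rows-last : ∀ {w e s} → Rows w e s → ∀ {j} → length w ≤ suc j → at e j ≡ 0
rows-last none                        _            = refl
rows-last (row none end)      {zero}  _            = refl
rows-last (row none end)      {suc j} _            = refl
rows-last (row (row r p′) p)  {suc j} (s≤s l)      = rows-last (row r p′) l
rows-last (row (row r p′) p)  {zero}  (s≤s ())

-- Besides ascents this covers positions at or past the end of the word, which arise since a dual
-- word may be shorter; there neither of the two variables occurs.
no-descent⇒sym : ∀ {i w} → Unique w → ¬ Descent i w → ∀ α → coeff (F w) α ≡ coeff (F w) (swapExp i α)
no-descent⇒sym {i} {w} u nd α with suc i <? length w
... | yes l with <-cmp (at w i) (at w (suc i))
...   | tri< lt _ _ = F-sym u (adjacent i w l lt) α
...   | tri> _ _ gt = ⊥-elim (nd (adjacent i w l gt))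
...   | tri≈ _ eq _ = ⊥-elim (at-≢ i w u l eq)
  where
  at-≢ : ∀ i w → Unique w → suc i < length w → at w i ≢ at w (suc i)
  at-≢ zero    (a ∷ b ∷ w) ((a≢b ∷ _) ∷ _) _       = a≢b
  at-≢ zero    (a ∷ [])    _               (s≤s ())
  at-≢ (suc i) (a ∷ w)     (_ ∷ u)         (s≤s l) = at-≢ i w u l
no-descent⇒sym {i} {w} u nd α | no nl = begin
  coeff (F w) α                         ≡⟨ coeff-F w α ⟩
  + ∑ (rows w) (weight α)               ≡⟨ cong +_ (∑-cong-∈ (rows w) same) ⟩
  + ∑ (rows w) (weight (swapExp i α))   ≡⟨ sym (coeff-F w _) ⟩
  coeff (F w) (swapExp i α) ∎
  where
  open ≡-Reasoning
  zeros : ∀ {e s j} → Rows w e s → i ≤ j → expAt (map +_ e) j ≡ + 0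
  zeros {e} {j = j} r i≤j = trans (expAt-map e j) (cong +_ (rows-last r (≤-trans (≮⇒≥ nl) (s≤s i≤j))))
  fixed : ∀ {e s} → Rows w e s → swapExp i (map +_ e) ~ map +_ e
  fixed {e} r = pointwise λ j → trans (expAt-swapExp i (map +_ e) j) (go j)
    where
    go : ∀ j → expAt (map +_ e) (swapIdx i j) ≡ expAt (map +_ e) j
    go j with j ≟ i | j ≟ suc i
    ... | yes refl | _ = trans (zeros r (n≤1+n i)) (sym (zeros r ≤-refl))
    ... | no _ | yes refl = trans (zeros r ≤-refl) (sym (zeros r (n≤1+n i)))
    ... | no p | no q = refl
  same : ∀ {es} → es ∈ rows w → weight α es ≡ weight (swapExp i α) es
  same {e , s} es∈ = cong (λ b → when (sorted s) (when b 1)) (trans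
    (sameExp-cong {map +_ e} {α} {swapExp i (map +_ e)} (~-trans fx) (~-trans (~-sym fx)))
    (sameExp-swapExp i (map +_ e) α))
    where fx = fixed (∈rows⇒Rows w es∈)

-- From F w to its dual

expAt-step-next : ∀ k α → expAt (step k α) (suc k) ≡ ℤ.pred (expAt α (suc k))
expAt-step-next k α = trans (expAt-addExp (unit (suc k) _) (inc k α) (suc k))
  (cong₂ ℤ._+_ (expAt-unit-≡ (suc k) _) (trans (expAt-addExp (unit k _) α (suc k))
    (trans (cong (ℤ._+ expAt α (suc k)) (expAt-unit-≢ k _ 1+n≢n)) (ℤₚ.+-identityˡ (expAt α (suc k))))))

expAt-step-other : ∀ {k j} α → j ≢ k → j ≢ suc k → expAt (step k α) j ≡ expAt α j
expAt-step-other {k} {j} α j≢k j≢k+1 = trans (expAt-addExp (unit (suc k) _) (inc k α) j)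
  (trans (cong (ℤ._+ expAt (inc k α) j) (expAt-unit-≢ (suc k) _ j≢k+1)) (trans (ℤₚ.+-identityˡ _)
    (trans (expAt-addExp (unit k _) α j)
      (trans (cong (ℤ._+ expAt α j) (expAt-unit-≢ k _ j≢k)) (ℤₚ.+-identityˡ _)))))

-- s_i x^δ = x^δ x_{i+1} / x_i, so complementing turns s_i into s_i followed by a shift.
swap-complement-swap : ∀ {n i} α → suc i < n →
  swapExp i (complementExp n (swapExp i α)) ~ complementExp n (step i α)
swap-complement-swap {n} {i} α i<n = pointwise λ j →
  trans (expAt-swapExp i (complementExp n (swapExp i α)) j) (go j)
  where
  open ≡-Reasoning
  n-i : + (n ∸ suc i) ≡ + 1 ℤ.+ + (n ∸ 2+ i)
  n-i = cong +_ (+-∸-assoc 1 i<n)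
  go : ∀ j → expAt (complementExp n (swapExp i α)) (swapIdx i j) ≡ expAt (complementExp n (step i α)) j
  go j with j ≟ i | j ≟ suc i
  ... | yes refl | _ = begin
    expAt (complementExp n (swapExp i α)) (suc i)    ≡⟨ expAt-complement-< (swapExp i α) i<n ⟩
    + (n ∸ 2+ i) ℤ.- expAt (swapExp i α) (suc i)
      ≡⟨ cong (λ z → + (n ∸ 2+ i) ℤ.- z) (trans (expAt-swapExp i α (suc i)) (cong (expAt α) (swapIdx-next i))) ⟩
    + (n ∸ 2+ i) ℤ.- expAt α i
      ≡⟨ solveℤ 2 (λ m a → m ⊟ a ⊜ (conℤ (+ 1) ⊞ m) ⊟ (conℤ (+ 1) ⊞ a)) refl (+ (n ∸ 2+ i)) (expAt α i) ⟩
    (+ 1 ℤ.+ + (n ∸ 2+ i)) ℤ.- ℤ.suc (expAt α i)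
      ≡⟨ cong₂ ℤ._-_ (sym n-i) (sym (expAt-step i α)) ⟩
    + (n ∸ suc i) ℤ.- expAt (step i α) i
      ≡⟨ sym (expAt-complement-< (step i α) (<-trans (n<1+n i) i<n)) ⟩
    expAt (complementExp n (step i α)) i ∎
  ... | no _ | yes refl = begin
    expAt (complementExp n (swapExp i α)) i          ≡⟨ expAt-complement-< (swapExp i α) (<-trans (n<1+n i) i<n) ⟩
    + (n ∸ suc i) ℤ.- expAt (swapExp i α) i
      ≡⟨ cong₂ ℤ._-_ n-i (trans (expAt-swapExp i α i) (cong (expAt α) (swapIdx-here i))) ⟩
    (+ 1 ℤ.+ + (n ∸ 2+ i)) ℤ.- expAt α (suc i)
      ≡⟨ solveℤ 2 (λ m a → (conℤ (+ 1) ⊞ m) ⊟ a ⊜ m ⊟ (conℤ (ℤ.- + 1) ⊞ a)) refl (+ (n ∸ 2+ i)) (expAt α (suc i)) ⟩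
    + (n ∸ 2+ i) ℤ.- ℤ.pred (expAt α (suc i))
      ≡⟨ cong (λ z → + (n ∸ 2+ i) ℤ.- z) (sym (expAt-step-next i α)) ⟩
    + (n ∸ 2+ i) ℤ.- expAt (step i α) (suc i)        ≡⟨ sym (expAt-complement-< (step i α) i<n) ⟩
    expAt (complementExp n (step i α)) (suc i) ∎
  ... | no j≢i | no j≢i+1 = begin
    expAt (complementExp n (swapExp i α)) j
      ≡⟨ expAt-addExp (δ n) (negFirst n (swapExp i α)) j ⟩
    expAt (δ n) j ℤ.+ expAt (negFirst n (swapExp i α)) j
      ≡⟨ cong (λ z → expAt (δ n) j ℤ.+ z) (negFirst-at (trans (expAt-swapExp i α j)
           (trans (cong (expAt α) (swapIdx-other j≢i j≢i+1)) (sym (expAt-step-other α j≢i j≢i+1))))) ⟩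
    expAt (δ n) j ℤ.+ expAt (negFirst n (step i α)) j
      ≡⟨ sym (expAt-addExp (δ n) (negFirst n (step i α)) j) ⟩
    expAt (complementExp n (step i α)) j ∎
    where
    negFirst-at : ∀ {β γ} → expAt β j ≡ expAt γ j → expAt (negFirst n β) j ≡ expAt (negFirst n γ) j
    negFirst-at {β} {γ} eq with j <? n
    ... | yes j<n = trans (expAt-negFirst-< β j<n) (trans (cong ℤ.-_ eq) (sym (expAt-negFirst-< γ j<n)))
    ... | no j≮n = trans (expAt-negFirst-≥ β (≮⇒≥ j≮n)) (trans eq (sym (expAt-negFirst-≥ γ (≮⇒≥ j≮n))))

inc-dec-comm : ∀ i k α → inc i (dec k α) ~ dec k (inc i α)
inc-dec-comm i k α = pointwise λ j → trans (expAt-addExp (unit i _) (dec k α) j)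
  (trans (cong (λ z → expAt (unit i (+ 1)) j ℤ.+ z) (expAt-addExp (unit k _) α j))
  (trans (solveℤ 3 (λ a b c → a ⊞ (b ⊞ c) ⊜ b ⊞ (a ⊞ c)) refl
    (expAt (unit i (+ 1)) j) (expAt (unit k (ℤ.- + 1)) j) (expAt α j))
  (sym (trans (expAt-addExp (unit k _) (inc i α) j)
    (cong (λ z → expAt (unit k (ℤ.- + 1)) j ℤ.+ z) (expAt-addExp (unit i _) α j))))))

sameExp-dec : ∀ k e α → sameExp (dec k e) α ≡ sameExp e (inc k α)
sameExp-dec k e α = sameExp-cong
  (λ p → ~-trans (~-sym (inc-dec k e)) (addExp-cong (unit k _) p))
  (λ p → ~-trans (addExp-cong (unit k _) p) (dec-inc k α))

module _ {n w u i} (uw : Unique w) (uu : Unique u) (d : Dual n w u) (i<n : suc i < n)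
         (nd : ¬ Descent i w) where

  private
    -- That is, s_i F u = (x_{i+1} / x_i) F u.
    coeff-swap : ∀ α → coeff (F u) (swapExp i α) ≡ coeff (F u) (step i α)
    coeff-swap α = begin
      coeff (F u) (swapExp i α)                                    ≡⟨ d (swapExp i α) ⟩
      coeff (F w) (complementExp n (swapExp i α))                  ≡⟨ no-descent⇒sym uw nd _ ⟩
      coeff (F w) (swapExp i (complementExp n (swapExp i α)))      ≡⟨ coeff-~ (F w) (swap-complement-swap α i<n) ⟩
      coeff (F w) (complementExp n (step i α))                     ≡⟨ sym (d (step i α)) ⟩
      coeff (F u) (step i α) ∎
      where open ≡-Reasoning

  -- Otherwise F u would be symmetric too, hence constant along `step` by `coeff-swap`, hence zero,
  -- although the code of u occurs in it.
  no-descent⇒dual-descent : Descent i u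
  no-descent⇒dual-descent with adjacent? (λ a b → b <? a) i u
  ... | yes p = p
  ... | no nd′ = ⊥-elim (path⇒coeff≢0 (code-path uu) (pointwise (λ _ → refl))
    (step-invariant⇒0 i (F u) (λ α → trans (no-descent⇒sym uu nd′ α) (coeff-swap α)) (map +_ (code u))))

  -- ∂_i F u = F u / x_i.
  coeff-swapAt : Descent i u → ∀ α → coeff (F (swapAt i u)) α ≡ coeff (F u) (inc i α)
  coeff-swapAt p α = trans (cancel-∂ i (F (swapAt i u)) G diff α) (coeff-G α)
    where
    open ≡-Reasoning
    G = ((+ 1 , unit i (ℤ.- + 1)) ∷ []) ⊗ F u
    coeff-G : ∀ α → coeff G α ≡ coeff (F u) (inc i α)
    coeff-G α = trans (coeff-⊗-term (+ 1) (unit i (ℤ.- + 1)) (F u) (λ f → sameExp-dec i f α)) (ℤₚ.*-identityˡ _)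
    diff : ∀ α → coeff (F (swapAt i u)) (dec i α) ℤ.- coeff (F (swapAt i u)) (dec (suc i) α) ≡
                 coeff G (dec i α) ℤ.- coeff G (dec (suc i) α)
    diff α = begin
      coeff (F (swapAt i u)) (dec i α) ℤ.- coeff (F (swapAt i u)) (dec (suc i) α)
        ≡⟨ F-∂ uu p α ⟩
      coeff (F u) α ℤ.- coeff (F u) (swapExp i α)
        ≡⟨ cong₂ ℤ._-_ (coeff-~ (F u) (~-sym (inc-dec i α)))
             (trans (coeff-swap α) (coeff-~ (F u) (~-sym (inc-dec-comm i (suc i) α)))) ⟩
      coeff (F u) (inc i (dec i α)) ℤ.- coeff (F u) (inc i (dec (suc i) α))
        ≡⟨ sym (cong₂ ℤ._-_ (coeff-G (dec i α)) (coeff-G (dec (suc i) α))) ⟩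
      coeff G (dec i α) ℤ.- coeff G (dec (suc i) α) ∎

  path-swapAt : ∀ {e} → Path u e → ∃ λ e₁ → Path (swapAt i u) e₁ × map +_ e₁ ~ dec i (map +_ e)
  path-swapAt {e} p = coeff≢0⇒path (λ eq → path⇒coeff≢0 p (~-sym (inc-dec i (map +_ e)))
    (trans (sym (coeff-swapAt no-descent⇒dual-descent (dec i (map +_ e)))) eq))

  -- If q := L u u_{i+1} were at most i, the first q rows of the top path of u would survive the
  -- division by x_i, and would be too heavy for u s_i.
  L-after-no-descent : ¬ L u (at u (suc i)) ≤ i
  L-after-no-descent q≤i = <⇒≱ (Λ-swapAt uu no-descent⇒dual-descent)
    (bound-by (proj₁ (proj₂ top)) (proj₂ (proj₂ top)) (proj₁ (proj₂ low)) (proj₂ (proj₂ low)))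
    where
    q = L u (at u (suc i))
    top = top-path uu
    low = path-swapAt (proj₁ (proj₂ top))
    bound-by : ∀ {e e₁} → Path u e → (∀ j → pre j e ≡ Λ j u) → Path (swapAt i u) e₁ →
      map +_ e₁ ~ dec i (map +_ e) → Λ q u ≤ Λ q (swapAt i u)
    bound-by {e} {e₁} p pre-e p₁ e₁~ = begin
      Λ q u                ≡⟨ sym (pre-e q) ⟩
      pre q e              ≡⟨ pre-cong q {e} {e₁} same ⟩
      pre q e₁             ≤⟨ path-top (Unique-resp-↭ (↭-sym (swapAt-↭ i u)) uu) p₁ q ⟩
      Λ q (swapAt i u) ∎
      where
      open ≤-Reasoning
      -- Division by x_i changes the exponent at position i only, and j < q ≤ i.
      same : ∀ {j} → j < q → at e j ≡ at e₁ j
      same {j} j<q = ℤₚ.+-injective (sym (trans (sym (expAt-map e₁ j)) (trans (expAt≡ e₁~ j)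
        (trans (expAt-addExp (unit i _) (map +_ e) j)
          (trans (cong (ℤ._+ expAt (map +_ e) j) (expAt-unit-≢ i _ (<⇒≢ (<-≤-trans j<q q≤i))))
            (trans (ℤₚ.+-identityˡ _) (expAt-map e j)))))))

  no-descent⇒dual-minimum : MinimumAfter i u
  no-descent⇒dual-minimum j≤i = L⇒minimum u uu (proj₁ (adjacent⁻ no-descent⇒dual-descent))
    (≰⇒> L-after-no-descent) (s≤s j≤i)

-- Pattern avoidance for a dual pair

minimum-suc : ∀ {i w} → MinimumAfter i w → Descent (suc i) w → MinimumAfter (suc i) w
minimum-suc m p {j} j≤ with m≤n⇒m<n∨m≡n j≤
... | inj₁ j<    = <-trans (proj₂ (adjacent⁻ p)) (m (s≤s⁻¹ j<))
... | inj₂ refl  = proj₂ (adjacent⁻ p)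

module _ {n w u} (w-length : length w ≡ n) (uw : Unique w) (uu : Unique u) (d : Dual n w u) where

  private
    d′ : Dual n u w
    d′ = dual-sym {n} {w} {u} d

  descent⇒minimum : ∀ i → Descent i w → MinimumAfter i w
  descent⇒minimum zero p z≤n = proj₂ (adjacent⁻ p)
  descent⇒minimum (suc i) p
    with i<n ← subst (2+ i <_) w-length (proj₁ (adjacent⁻ p)) | adjacent? (λ a b → b <? a) (suc i) u
  ... | no nd  = no-descent⇒dual-minimum {w = u} {u = w} uu uw d′ i<n nd
  ... | yes pu with adjacent? (λ a b → b <? a) i w
  ...   | yes p′ = minimum-suc (descent⇒minimum i p′) p
  -- As w has no descent at i, u has its minimum after i, and by its own descent also after suc i.
  -- That entry of u has `L` equal to i + 2, so the code of w cannot drop at suc i, against the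
  -- descent there.
  ...   | no nd′ = ⊥-elim (<⇒≱ (code-descent p)
    (code-no-drop {w = u} {u = w} uu uw d′ i<n (at-∈ u lu) (minimum⇒L u uu lu (λ j< → min (s≤s⁻¹ j<)))))
    where
    lu = proj₁ (adjacent⁻ pu)
    min : MinimumAfter (suc i) u
    min = minimum-suc (no-descent⇒dual-minimum {w = w} {u = u} uw uu d (<-trans (n<1+n (suc i)) i<n) nd′) pu

  -- A discrete intermediate value argument; it turns a pattern with distant entries into a descent
  -- between neighbours.
  crossing : ∀ m {j} k → j < k → m < at w j → at w k ≤ m →
    ∃ λ l → j ≤ l × l < k × m < at w l × at w (suc l) ≤ m
  crossing m {j} (suc k) j≤k m<j k≤m with m <? at w k
  ... | yes m<k = k , s≤s⁻¹ j≤k , ≤-refl , m<k , k≤m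
  ... | no m≮k with m≤n⇒m<n∨m≡n (s≤s⁻¹ j≤k)
  ...   | inj₂ refl = ⊥-elim (m≮k m<j)
  ...   | inj₁ j<k with l , j≤l , l<k , m<l , l≤m ← crossing m k j<k m<j (≮⇒≥ m≮k) =
    l , j≤l , m<n⇒m<1+n l<k , m<l , l≤m

  -- Between i and j the word falls past w_k at some l. The code at l counts both w_{l+1} and w_k,
  -- the code at l + 1 neither, so it drops by at least 2.
  avoids312 : Avoids312 w
  avoids312 i j k i<j j<k k<w (j<k′ , k<i′)
    with l , i≤l , l<j , k<l′ , l≤k′ ← crossing (at w k) j i<j k<i′ (<⇒≤ j<k′) =
    <⇒≱ (code-jump l w (≤-<-trans l<j j<k) k<w k<l′ l≤k′)
      (code-drop {w = u} {u = w} uu uw d′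
        (subst (suc l <_) w-length (<-trans (≤-<-trans l<j j<k) k<w)))
    where
    code-jump : ∀ l w {k} → suc l < k → k < length w → at w k < at w l → at w (suc l) ≤ at w k →
      suc (at (code w) (suc l)) < at (code w) l
    code-jump zero (a ∷ b ∷ w) {suc (suc k)} _ (s≤s (s≤s l)) k<a b≤k
      rewrite smaller-∷-< w (≤-<-trans b≤k k<a) = s≤s (∑-mono-< {xs = w}
        (λ {z} _ → when-≤ {z <ᵇ b} {z <ᵇ a} (λ z<b → <⇒<ᵇ≡true (<-trans (<ᵇ≡true⇒< {z} {b} z<b) (≤-<-trans b≤k k<a))))
        (at-∈ w l)
        (subst₂ (λ p q → when p 1 < when q 1) (sym (≮⇒<ᵇ≡false (≤⇒≯ b≤k))) (sym (<⇒<ᵇ≡true k<a)) ≤-refl))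
    code-jump zero (a ∷ b ∷ w) {suc zero} (s≤s ())
    code-jump zero (a ∷ []) {suc k} _ (s≤s ())
    code-jump (suc l) (a ∷ w) {suc k} (s≤s l<) (s≤s k<) = code-jump l w l< k<

  -- Between j and k the word falls past w_k at some l, and w_{l+1} is below w_i by
  -- `descent⇒minimum`. Then l + 1 = k contradicts w_i < w_k, and otherwise l, l + 1, k form a 312.
  avoids132 : Avoids132 w
  avoids132 i j k i<j j<k k<w (i<k′ , k<j′)
    with l , j≤l , l<k , k<l′ , l≤k′ ← crossing (at w k) k j<k k<j′ ≤-refl
    with min ← descent⇒minimum l (adjacent l w (≤-<-trans l<k k<w) (≤-<-trans l≤k′ k<l′))
                 {i} (<⇒≤ (<-≤-trans i<j j≤l))
    with m≤n⇒m<n∨m≡n l<k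
  ... | inj₂ refl = <⇒≯ i<k′ min
  ... | inj₁ l<k′ = avoids312 l (suc l) k ≤-refl l<k′ k<w (<-trans min i<k′ , k<l′)

-- Reflecting the values

AllPairs-at : ∀ {R : ℕ → ℕ → Set} w →
  (∀ {j k} → j < k → k < length w → R (at w j) (at w k)) → AllPairs R w
AllPairs-at []      h = []
AllPairs-at (a ∷ w) h = All-at w (λ l → h (s≤s z≤n) (s≤s l)) ∷ AllPairs-at w (λ l m → h (s≤s l) (s≤s m))
  where
  All-at : ∀ {P : ℕ → Set} w → (∀ {k} → k < length w → P (at w k)) → All P w
  All-at []      h = []
  All-at (a ∷ w) h = h (s≤s z≤n) ∷ All-at w (λ l → h (s≤s l))

avoids132⇒dominant : ∀ w → Avoids132 w → Dominant w
avoids132⇒dominant []      _  = []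
avoids132⇒dominant (a ∷ w) av =
  AllPairs-at w (λ {j} {k} j<k k<w (a<k , k<j) → av 0 (suc j) (suc k) (s≤s z≤n) (s≤s j<k) (s≤s k<w) (a<k , k<j)) ∷
  avoids132⇒dominant w (λ i j k i<j j<k k<w → av (suc i) (suc j) (suc k) (s≤s i<j) (s≤s j<k) (s≤s k<w))

reflect : ℕ → List ℕ → List ℕ
reflect n = map (suc n ∸_)

at-map : ∀ (f : ℕ → ℕ) w {i} → i < length w → at (map f w) i ≡ f (at w i)
at-map f (a ∷ w) {zero}  _       = refl
at-map f (a ∷ w) {suc i} (s≤s l) = at-map f w l

reflect-perm : ∀ {n w} → IsPerm n w → IsPerm n (reflect n w)
reflect-perm {n} p = ↭trans (↭-map⁺ (suc n ∸_) p) (subst (_↭ range n) eq (↭-reverse (range n)))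
  where
  applyUpTo-∸ : ∀ n → applyUpTo (n ∸_) n ≡ applyDownFrom suc n
  applyUpTo-∸ zero    = refl
  applyUpTo-∸ (suc n) = cong (suc n ∷_) (applyUpTo-∸ n)
  eq : reverse (range n) ≡ map (suc n ∸_) (range n)
  eq = trans (cong reverse (map-applyUpTo id suc n)) (trans (reverse-applyUpTo suc n)
    (sym (trans (cong (map (suc n ∸_)) (map-applyUpTo id suc n))
      (trans (map-applyUpTo suc (suc n ∸_) n) (applyUpTo-∸ n)))))

∸-cancelˡ-< : ∀ o {m n} → o ∸ m < o ∸ n → n < m
∸-cancelˡ-< o lt = ≰⇒> (λ m≤n → <⇒≱ lt (∸-monoʳ-≤ o m≤n))

reflect-avoids132 : ∀ {n w} → Avoids312 w → Avoids132 (reflect n w)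
reflect-avoids132 {n} {w} av i j k i<j j<k k<u
  with k<w ← subst (k <_) (length-map (suc n ∸_) w) k<u
  rewrite at-map (suc n ∸_) w k<w | at-map (suc n ∸_) w (<-trans j<k k<w)
        | at-map (suc n ∸_) w (<-trans i<j (<-trans j<k k<w)) =
  λ (i<k , k<j) → av i j k i<j j<k k<w (∸-cancelˡ-< (suc n) k<j , ∸-cancelˡ-< (suc n) i<k)

perm-≤ : ∀ {n w} → IsPerm n w → All (_≤ n) w
perm-≤ {n} p = All-resp-↭ (↭-sym p) (Allₚ.map⁺ (Allₚ.applyUpTo⁺₁ id n id))

-- Reflection makes the larger entries the smaller ones, and each entry of w is on one side of a.
smaller-reflect : ∀ {n a w} → a ≤ n → All (_≤ n) w → All (a ≢_) w →
  smaller (suc n ∸ a) (reflect n w) + smaller a w ≡ length w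
smaller-reflect a≤n [] [] = refl
smaller-reflect {n} {a} {z ∷ w} a≤n (z≤n′ ∷ b) (a≢z ∷ a≢w) with <-cmp a z
... | tri≈ _ a≡z _ = ⊥-elim (a≢z a≡z)
... | tri< a<z _ z≮a
  rewrite ≮⇒<ᵇ≡false z≮a | <⇒<ᵇ≡true (∸-monoʳ-< {suc n} a<z (m≤n⇒m≤1+n z≤n′)) =
  cong suc (smaller-reflect a≤n b a≢w)
... | tri> _ _ z<a
  rewrite <⇒<ᵇ≡true z<a | ≮⇒<ᵇ≡false (≤⇒≯ (∸-monoʳ-≤ (suc n) (<⇒≤ z<a))) =
  trans (+-suc _ _) (cong suc (smaller-reflect a≤n b a≢w))

code-reflect : ∀ {n w} → All (_≤ n) w → Unique w → ∀ j →
  at (code (reflect n w)) j + at (code w) j ≡ length w ∸ suc j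
code-reflect []      _             j       = refl
code-reflect (p ∷ b) (a≢w ∷ _)     zero    = smaller-reflect p b a≢w
code-reflect (_ ∷ b) (_ ∷ u)       (suc j) = code-reflect b u j

at-code-≥ : ∀ w {j} → length w ≤ j → at (code w) j ≡ 0
at-code-≥ []              _       = refl
at-code-≥ (a ∷ w) {suc j} (s≤s l) = at-code-≥ w l

reflect-dual : ∀ {n w} → IsPerm n w → Avoids132 w → Avoids312 w → Dual n w (reflect n w)
reflect-dual {n} {w} perm av av′ α = begin
  coeff (F u) α                                  ≡⟨ F-dominant (perm-Unique (reflect-perm perm))
                                                      (avoids132⇒dominant u (reflect-avoids132 {n} {w} av′)) α ⟩
  + hit (code u) α
    ≡⟨ cong (λ b → + when b 1) (trans
         (sameExp-cong {map +_ (code u)} {α} {complementExp n (map +_ (code w))} (~-trans (~-sym exps)) (~-trans exps))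
         (sameExp-complement n (map +_ (code w)) α)) ⟩
  + hit (code w) (complementExp n α)
    ≡⟨ sym (F-dominant (perm-Unique perm) (avoids132⇒dominant w av) (complementExp n α)) ⟩
  coeff (F w) (complementExp n α) ∎
  where
  open ≡-Reasoning
  u = reflect n w
  exps : map +_ (code u) ~ complementExp n (map +_ (code w))
  exps = pointwise go
    where
    go : ∀ j → expAt (map +_ (code u)) j ≡ expAt (complementExp n (map +_ (code w))) j
    go j with j <? n
    ... | yes j<n = sym (begin
      expAt (complementExp n (map +_ (code w))) j        ≡⟨ expAt-complement-< (map +_ (code w)) j<n ⟩
      + (n ∸ suc j) ℤ.- expAt (map +_ (code w)) j
        ≡⟨ cong₂ (λ l z → + (l ∸ suc j) ℤ.- z) (sym (perm-length perm)) (expAt-map (code w) j) ⟩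
      + (length w ∸ suc j) ℤ.- + at (code w) j
        ≡⟨ cong (λ m → + m ℤ.- + at (code w) j) (sym (code-reflect (perm-≤ perm) (perm-Unique perm) j)) ⟩
      + (at (code u) j + at (code w) j) ℤ.- + at (code w) j
        ≡⟨ cong (ℤ._- + at (code w) j) (ℤₚ.pos-+ (at (code u) j) (at (code w) j)) ⟩
      (+ at (code u) j ℤ.+ + at (code w) j) ℤ.- + at (code w) j
        ≡⟨ solveℤ 2 (λ a b → (a ⊞ b) ⊟ b ⊜ a) refl (+ at (code u) j) (+ at (code w) j) ⟩
      + at (code u) j                                    ≡⟨ sym (expAt-map (code u) j) ⟩
      expAt (map +_ (code u)) j ∎)
    -- From position n on nothing is complemented, and both codes have ended.
    ... | no j≮n = trans (vanish u (perm-length (reflect-perm perm)))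
      (sym (trans (expAt-complement-≥ _ (≮⇒≥ j≮n)) (vanish w (perm-length perm))))
      where
      vanish : ∀ v → length v ≡ n → expAt (map +_ (code v)) j ≡ + 0
      vanish v l = trans (expAt-map (code v) j) (cong +_ (at-code-≥ v (subst (_≤ j) (sym l) (≮⇒≥ j≮n))))

theorem1p1 : (n : ℕ) → 1 ≤ n → (w : List ℕ) → IsPerm n w →
    (P : Poly) → Schubert n w P →
    (IsSchubertPoly (xδ n ⊗ invSub n P) ⇔ (Avoids132 w × Avoids312 w))
theorem1p1 n _ w perm P S = mk⇔ only-if if
  where
  P≈F : P ≈ F w
  P≈F = proj₂ (Schubert⇒F S)
  inverse : ∀ α → coeff (xδ n ⊗ invSub n P) α ≡ coeff (F w) (complementExp n α)
  inverse α = trans (coeff-complement n P α) (P≈F (complementExp n α))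
  only-if : IsSchubertPoly (xδ n ⊗ invSub n P) → Avoids132 w × Avoids312 w
  only-if (m , u , Q , permu , SQ , Q≈) =
    avoids132 {u = u} (perm-length perm) (perm-Unique perm) (perm-Unique permu) d ,
    avoids312 {u = u} (perm-length perm) (perm-Unique perm) (perm-Unique permu) d
    where
    d : Dual n w u
    d α = trans (sym (proj₂ (Schubert⇒F SQ) α)) (trans (Q≈ α) (inverse α))
  if : Avoids132 w × Avoids312 w → IsSchubertPoly (xδ n ⊗ invSub n P)
  if (av , av′) = n , reflect n w , F (reflect n w) , reflect-perm perm , F-Schubert (reflect-perm perm) ,
    λ α → trans (reflect-dual perm av av′ α) (sym (inverse α))
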